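{- Let $p\in\mathbb{R}[x]$ be a polynomial. Then the sequence $f(n)=\lfloor p(n)\rfloor$, $n\ge 0$, is regular if and only if all the coefficients of $p$, except possibly for the constant term, are rational.
   Context: $\mathbb{N}_0=\{0,1,2,\dots\}$. Let $k\ge 2$ be an integer. The $k$-kernel of a sequence $(a_n)_{n\ge0}$ is the set of its subsequences $\{(a_{k^l n+r})_{n\ge 0} : l\ge 0,\ 0\le r<k^l\}$. A sequence $(a_n)_{n\ge 0}$ of integers is $k$-regular if its $k$-kernel spans a finitely generated abelian subgroup of $\mathbb{Z}^{\mathbb{N}_0}$. A sequence is regular if it is $k$-regular for some integer $k\ge 2$. -}

module Defs where

open import Algebra.Bundles using (AbelianGroup)
import Algebra.Construct.Pointwise as Pointwise
open import Axiom.ExcludedMiddle using (ExcludedMiddle)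
open import Data.Integer.Base as ℤ using (ℤ)
import Data.Integer.DivMod as ℤ
import Data.Integer.Properties as ℤ
open import Data.List.Base using (List; foldr)
import Data.List.Membership.Setoid as Membership
open import Data.Nat.Base as ℕ using (ℕ)
import Data.Nat.Properties as ℕ
open import Data.Product.Base using (∃-syntax; _×_; _,_; proj₁; proj₂)
open import Data.Rational.Base as ℚ using (ℚ; 0ℚ; 1ℚ; ½; ∣_∣)
import Data.Rational.Properties as ℚ
import Data.Rational.Unnormalised.Base as ℚᵘ
import Data.Rational.Unnormalised.Properties as ℚᵘ
open import Data.Rational.Solver using (module +-*-Solver)
open import Data.Sum.Base using (inj₁; inj₂)
open import Level using (Level; 0ℓ; _⊔_)
open import Relation.Binary.PropositionalEquality
  using (_≡_; _≗_; refl; sym; trans; cong; subst)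
open import Relation.Nullary using (¬_; yes; no)
open import Relation.Nullary.Decidable using (decidable-stable)
open import Relation.Unary using (Pred; _≐_)

-- Real numbers: Cauchy sequences of rationals, with _≈_ as equality.
record ℝ : Set where
  field
    seq    : ℕ → ℚ
    cauchy : ∀ ε → 0ℚ ℚ.< ε →
             ∃[ N ] ∀ m n → N ℕ.≤ m → N ℕ.≤ n → ∣ seq m ℚ.- seq n ∣ ℚ.≤ ε

open ℝ public

infix 4 _≈_ _≤_ _<_

_≈_ : ℝ → ℝ → Set
x ≈ y = ∀ ε → 0ℚ ℚ.< ε → ∃[ N ] ∀ n → N ℕ.≤ n → ∣ seq x n ℚ.- seq y n ∣ ℚ.≤ ε

_≤_ : ℝ → ℝ → Set
x ≤ y = ∀ ε → 0ℚ ℚ.< ε → ∃[ N ] ∀ n → N ℕ.≤ n → seq x n ℚ.≤ seq y n ℚ.+ ε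

_<_ : ℝ → ℝ → Set
x < y = ∃[ ε ] 0ℚ ℚ.< ε × (∃[ N ] ∀ n → N ℕ.≤ n → seq x n ℚ.+ ε ℚ.≤ seq y n)

fromℚ : ℚ → ℝ
fromℚ q = record
  { seq    = λ _ → q
  ; cauchy = λ ε 0<ε → 0 , λ _ _ _ _ →
      subst (ℚ._≤ ε) (sym (cong ∣_∣ (ℚ.+-inverseʳ q))) (ℚ.<⇒≤ 0<ε)
  }

fromℤ : ℤ → ℝ
fromℤ z = fromℚ (z ℚ./ 1)

fromℕ : ℕ → ℝ
fromℕ n = fromℤ (ℤ.+ n)

private
  open ℚ.≤-Reasoning

  half-positive : ∀ {ε} → 0ℚ ℚ.< ε → 0ℚ ℚ.< ½ ℚ.* ε
  half-positive 0<ε = ℚ.*-monoʳ-<-pos ½ 0<ε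

  half+half : ∀ ε → ½ ℚ.* ε ℚ.+ ½ ℚ.* ε ≡ ε
  half+half ε = trans (sym (ℚ.*-distribʳ-+ ε ½ ½)) (ℚ.*-identityˡ ε)

  split : ∀ u v → u ≡ v ℚ.+ (u ℚ.- v)
  split = solve 2 (λ u v → u := v :+ (u :- v)) refl
    where open +-*-Solver

  abs-close : ∀ p q {ε} → ∣ p ℚ.- q ∣ ℚ.≤ ε → p ℚ.≤ q ℚ.+ ε
  abs-close p q {ε} close = begin
    p                   ≡⟨ split p q ⟩
    q ℚ.+ (p ℚ.- q)     ≤⟨ ℚ.+-monoʳ-≤ q (ℚ.≤-trans (p≤∣p∣ (p ℚ.- q)) close) ⟩
    q ℚ.+ ε             ∎
    where
    p≤∣p∣ : ∀ p → p ℚ.≤ ∣ p ∣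
    p≤∣p∣ p with ℚ.≤-total 0ℚ p
    ... | inj₁ 0≤p = ℚ.≤-reflexive (sym (ℚ.0≤p⇒∣p∣≡p 0≤p))
    ... | inj₂ p≤0 = ℚ.≤-trans p≤0 (ℚ.0≤∣p∣ p)

  eventually-bounded : ∀ (x : ℝ) →
    ∃[ B ] 0ℚ ℚ.< B × (∃[ N ] ∀ n → N ℕ.≤ n → ∣ seq x n ∣ ℚ.≤ B)
  eventually-bounded x with cauchy x 1ℚ (ℚ.positive⁻¹ 1ℚ)
  ... | N , close = B , 0<B , N , bound
    where
    a = seq x N
    B = ∣ a ∣ ℚ.+ 1ℚ

    0<B : 0ℚ ℚ.< B
    0<B = ℚ.+-mono-≤-< (ℚ.0≤∣p∣ a) (ℚ.positive⁻¹ 1ℚ)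

    bound : ∀ n → N ℕ.≤ n → ∣ seq x n ∣ ℚ.≤ B
    bound n N≤n = begin
      ∣ seq x n ∣                     ≡⟨ cong ∣_∣ (split (seq x n) a) ⟩
      ∣ a ℚ.+ (seq x n ℚ.- a) ∣       ≤⟨ ℚ.∣p+q∣≤∣p∣+∣q∣ a _ ⟩
      ∣ a ∣ ℚ.+ ∣ seq x n ℚ.- a ∣     ≤⟨ ℚ.+-monoʳ-≤ ∣ a ∣ (close n N N≤n ℕ.≤-refl) ⟩
      ∣ a ∣ ℚ.+ 1ℚ                    ∎

  *-mono-≤-nonNeg : ∀ {p q r s} → 0ℚ ℚ.≤ r → 0ℚ ℚ.≤ q →
                    p ℚ.≤ q → r ℚ.≤ s → p ℚ.* r ℚ.≤ q ℚ.* s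
  *-mono-≤-nonNeg {p} {q} {r} {s} 0≤r 0≤q p≤q r≤s = begin
    p ℚ.* r ≤⟨ ℚ.*-monoʳ-≤-nonNeg r {{ℚ.nonNegative 0≤r}} p≤q ⟩
    q ℚ.* r ≤⟨ ℚ.*-monoˡ-≤-nonNeg q {{ℚ.nonNegative 0≤q}} r≤s ⟩
    q ℚ.* s ∎

infixl 6 _+_
infixl 7 _*_

_+_ : ℝ → ℝ → ℝ
x + y = record { seq = λ n → seq x n ℚ.+ seq y n ; cauchy = cauchy-+ }
  where
  rearrange : ∀ a b c d → (a ℚ.+ b) ℚ.- (c ℚ.+ d) ≡ (a ℚ.- c) ℚ.+ (b ℚ.- d)
  rearrange = solve 4 (λ a b c d → (a :+ b) :- (c :+ d) := (a :- c) :+ (b :- d)) refl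
    where open +-*-Solver

  cauchy-+ : ∀ ε → 0ℚ ℚ.< ε → ∃[ N ] ∀ m n → N ℕ.≤ m → N ℕ.≤ n →
             ∣ (seq x m ℚ.+ seq y m) ℚ.- (seq x n ℚ.+ seq y n) ∣ ℚ.≤ ε
  cauchy-+ ε 0<ε with cauchy x _ (half-positive 0<ε) | cauchy y _ (half-positive 0<ε)
  ... | M , close-x | N , close-y = M ℕ.⊔ N , λ m n N≤m N≤n → begin
    ∣ (seq x m ℚ.+ seq y m) ℚ.- (seq x n ℚ.+ seq y n) ∣
      ≡⟨ cong ∣_∣ (rearrange (seq x m) (seq y m) (seq x n) (seq y n)) ⟩
    ∣ (seq x m ℚ.- seq x n) ℚ.+ (seq y m ℚ.- seq y n) ∣
      ≤⟨ ℚ.∣p+q∣≤∣p∣+∣q∣ (seq x m ℚ.- seq x n) _ ⟩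
    ∣ seq x m ℚ.- seq x n ∣ ℚ.+ ∣ seq y m ℚ.- seq y n ∣
      ≤⟨ ℚ.+-mono-≤ (close-x m n (ℕ.m⊔n≤o⇒m≤o M N N≤m) (ℕ.m⊔n≤o⇒m≤o M N N≤n))
                    (close-y m n (ℕ.m⊔n≤o⇒n≤o M N N≤m) (ℕ.m⊔n≤o⇒n≤o M N N≤n)) ⟩
    ½ ℚ.* ε ℚ.+ ½ ℚ.* ε
      ≡⟨ half+half ε ⟩
    ε ∎

_*_ : ℝ → ℝ → ℝ
x * y = record { seq = λ n → seq x n ℚ.* seq y n ; cauchy = cauchy-* }
  where
  rearrange : ∀ a b c d →
    a ℚ.* b ℚ.- c ℚ.* d ≡ a ℚ.* (b ℚ.- d) ℚ.+ d ℚ.* (a ℚ.- c)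
  rearrange = solve 4 (λ a b c d → a :* b :- c :* d := a :* (b :- d) :+ d :* (a :- c)) refl
    where open +-*-Solver

  product-small : ∀ {B η} → 0ℚ ℚ.< B → 0ℚ ℚ.< η →
    ∃[ δ ] 0ℚ ℚ.< δ × (∀ u v → ∣ u ∣ ℚ.≤ B → ∣ v ∣ ℚ.≤ δ → ∣ u ℚ.* v ∣ ℚ.≤ η)
  product-small {B} {η} 0<B 0<η = δ , 0<δ , bound
    where
    instance
      B>0 = ℚ.positive 0<B
      B≢0 = ℚ.pos⇒nonZero B

    δ = ℚ.1/ B ℚ.* η

    0<δ : 0ℚ ℚ.< δ
    0<δ = ℚ.positive⁻¹ δ
      {{ℚ.pos*pos⇒pos (ℚ.1/ B) {{ℚ.1/pos⇒pos B}} η {{ℚ.positive 0<η}}}}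

    bound : ∀ u v → ∣ u ∣ ℚ.≤ B → ∣ v ∣ ℚ.≤ δ → ∣ u ℚ.* v ∣ ℚ.≤ η
    bound u v u≤B v≤δ = begin
      ∣ u ℚ.* v ∣            ≡⟨ ℚ.∣p*q∣≡∣p∣*∣q∣ u v ⟩
      ∣ u ∣ ℚ.* ∣ v ∣        ≤⟨ *-mono-≤-nonNeg (ℚ.0≤∣p∣ v) (ℚ.<⇒≤ 0<B) u≤B v≤δ ⟩
      B ℚ.* (ℚ.1/ B ℚ.* η)   ≡⟨ ℚ.*-assoc B (ℚ.1/ B) η ⟨
      (B ℚ.* ℚ.1/ B) ℚ.* η   ≡⟨ cong (ℚ._* η) (ℚ.*-inverseʳ B) ⟩
      1ℚ ℚ.* η               ≡⟨ ℚ.*-identityˡ η ⟩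
      η                      ∎

  cauchy-* : ∀ ε → 0ℚ ℚ.< ε → ∃[ N ] ∀ m n → N ℕ.≤ m → N ℕ.≤ n →
             ∣ seq x m ℚ.* seq y m ℚ.- seq x n ℚ.* seq y n ∣ ℚ.≤ ε
  cauchy-* ε 0<ε =
    let A , 0<A , K , x≤A = eventually-bounded x
        B , 0<B , L , y≤B = eventually-bounded y
        δ , 0<δ , smallB = product-small 0<B (half-positive 0<ε)
        δ′ , 0<δ′ , smallA = product-small 0<A (half-positive 0<ε)
        M , close-x = cauchy x δ 0<δ
        N , close-y = cauchy y δ′ 0<δ′
    in (K ℕ.⊔ L) ℕ.⊔ (M ℕ.⊔ N) , λ m n ≤m ≤n →
    let KL≤m = ℕ.m⊔n≤o⇒m≤o (K ℕ.⊔ L) (M ℕ.⊔ N) ≤m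
        KL≤n = ℕ.m⊔n≤o⇒m≤o (K ℕ.⊔ L) (M ℕ.⊔ N) ≤n
        MN≤m = ℕ.m⊔n≤o⇒n≤o (K ℕ.⊔ L) (M ℕ.⊔ N) ≤m
        MN≤n = ℕ.m⊔n≤o⇒n≤o (K ℕ.⊔ L) (M ℕ.⊔ N) ≤n
    in begin
    ∣ seq x m ℚ.* seq y m ℚ.- seq x n ℚ.* seq y n ∣
      ≡⟨ cong ∣_∣ (rearrange (seq x m) (seq y m) (seq x n) (seq y n)) ⟩
    ∣ seq x m ℚ.* (seq y m ℚ.- seq y n) ℚ.+ seq y n ℚ.* (seq x m ℚ.- seq x n) ∣
      ≤⟨ ℚ.∣p+q∣≤∣p∣+∣q∣ (seq x m ℚ.* (seq y m ℚ.- seq y n))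
                       (seq y n ℚ.* (seq x m ℚ.- seq x n)) ⟩
    ∣ seq x m ℚ.* (seq y m ℚ.- seq y n) ∣ ℚ.+ ∣ seq y n ℚ.* (seq x m ℚ.- seq x n) ∣
      ≤⟨ ℚ.+-mono-≤
           (smallA (seq x m) (seq y m ℚ.- seq y n) (x≤A m (ℕ.m⊔n≤o⇒m≤o K L KL≤m))
             (close-y m n (ℕ.m⊔n≤o⇒n≤o M N MN≤m) (ℕ.m⊔n≤o⇒n≤o M N MN≤n)))
           (smallB (seq y n) (seq x m ℚ.- seq x n) (y≤B n (ℕ.m⊔n≤o⇒n≤o K L KL≤n))
             (close-x m n (ℕ.m⊔n≤o⇒m≤o M N MN≤m) (ℕ.m⊔n≤o⇒m≤o M N MN≤n))) ⟩
    ½ ℚ.* ε ℚ.+ ½ ℚ.* ε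
      ≡⟨ half+half ε ⟩
    ε ∎

IsRational : ℝ → Set
IsRational x = ∃[ q ] x ≈ fromℚ q

-- Real polynomials: coefficients are listed from the constant term up,
-- and trailing zeros are allowed.
Polynomial : Set
Polynomial = List ℝ

eval : Polynomial → ℝ → ℝ
eval p x = foldr (λ a v → a + x * v) (fromℚ 0ℚ) p

-- z = ⌊ x ⌋.  The floor is a relation because it is not a computable
-- function of x; floor-exists shows that it is total classically.
_IsFloorOf_ : ℤ → ℝ → Set
z IsFloorOf x = fromℤ z ≤ x × x < fromℤ (ℤ.suc z)

private
  ≮⇒≥ : ∀ x q → ¬ (x < fromℚ q) → fromℚ q ≤ x
  ≮⇒≥ x q x≮q ε 0<ε = N , λ n N≤n → begin
    q                         ≤⟨ decidable-stable (q ℚ.≤? _) ¬¬q≤ ⟩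
    seq x N ℚ.+ h             ≤⟨ ℚ.+-monoˡ-≤ h (abs-close (seq x N) (seq x n) (close N n ℕ.≤-refl N≤n)) ⟩
    seq x n ℚ.+ η ℚ.+ h       ≤⟨ ℚ.+-monoˡ-≤ h (ℚ.+-monoʳ-≤ (seq x n) η≤h) ⟩
    seq x n ℚ.+ h ℚ.+ h       ≡⟨ ℚ.+-assoc (seq x n) h h ⟩
    seq x n ℚ.+ (h ℚ.+ h)     ≡⟨ cong (seq x n ℚ.+_) (half+half ε) ⟩
    seq x n ℚ.+ ε             ∎
    where
    h = ½ ℚ.* ε
    η = ½ ℚ.* h

    0<η : 0ℚ ℚ.< η
    0<η = half-positive (half-positive 0<ε)

    η≤h : η ℚ.≤ h
    η≤h = begin
      η           ≡⟨ ℚ.+-identityʳ η ⟨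
      η ℚ.+ 0ℚ    ≤⟨ ℚ.+-monoʳ-≤ η (ℚ.<⇒≤ 0<η) ⟩
      η ℚ.+ η     ≡⟨ half+half h ⟩
      h           ∎

    N     = proj₁ (cauchy x η 0<η)
    close = proj₂ (cauchy x η 0<η)

    ¬¬q≤ : ¬ ¬ (q ℚ.≤ seq x N ℚ.+ h)
    ¬¬q≤ q≰ = x≮q (η , 0<η , N , λ n N≤n → begin
      seq x n ℚ.+ η             ≤⟨ ℚ.+-monoˡ-≤ η (abs-close (seq x n) (seq x N) (close n N N≤n ℕ.≤-refl)) ⟩
      seq x N ℚ.+ η ℚ.+ η       ≡⟨ ℚ.+-assoc (seq x N) η η ⟩
      seq x N ℚ.+ (η ℚ.+ η)     ≡⟨ cong (seq x N ℚ.+_) (half+half h) ⟩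
      seq x N ℚ.+ h             <⟨ ℚ.≰⇒> q≰ ⟩
      q                         ∎)

  floor-≤ : ∀ q → ℚ.floor q ℚ./ 1 ℚ.≤ q
  floor-≤ q@(ℚ.mkℚ n d-1 _) = ℚ.toℚᵘ-cancel-≤ (ℚᵘ.≤-respˡ-≃
    (ℚᵘ.≃-sym (ℚ.toℚᵘ-fromℚᵘ (ℚᵘ.mkℚᵘ (ℚ.floor q) 0)))
    (ℚᵘ.*≤* (subst (ℚ.floor q ℤ.* ℚ.↧ q ℤ.≤_) (sym (ℤ.*-identityʳ n))
      (ℤ.[n/d]*d≤n n (ℚ.↧ q)))))

  <-suc-floor : ∀ q → q ℚ.< ℤ.suc (ℚ.floor q) ℚ./ 1
  <-suc-floor q@(ℚ.mkℚ n d-1 _) = ℚ.toℚᵘ-cancel-< (ℚᵘ.<-respʳ-≃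
    (ℚᵘ.≃-sym (ℚ.toℚᵘ-fromℚᵘ (ℚᵘ.mkℚᵘ (ℤ.suc (ℚ.floor q)) 0)))
    (ℚᵘ.*<* (subst (ℤ._< ℤ.suc (ℚ.floor q) ℤ.* ℚ.↧ q) (sym (ℤ.*-identityʳ n))
      (subst (λ z → n ℤ.< ℤ.suc z ℤ.* ℚ.↧ q) (sym (ℤ.*-identityˡ (n ℤ./ℕ ℚ.↧ₙ q)))
        (ℤ.n<s[n/ℕd]*d n (ℚ.↧ₙ q))))))

  suc-/1 : ∀ z → ℤ.suc z ℚ./ 1 ≡ z ℚ./ 1 ℚ.+ 1ℚ
  suc-/1 z = ℚ.toℚᵘ-injective (ℚᵘ.≃-trans (ℚ.toℚᵘ-fromℚᵘ (ℚᵘ.mkℚᵘ (ℤ.suc z) 0))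
    (ℚᵘ.≃-sym (ℚᵘ.≃-trans (ℚ.toℚᵘ-homo-+ (z ℚ./ 1) 1ℚ)
      (ℚᵘ.≃-trans (ℚᵘ.+-congˡ ℚᵘ.1ℚᵘ (ℚ.toℚᵘ-fromℚᵘ (ℚᵘ.mkℚᵘ z 0)))
        (ℚᵘ.*≡* (arith z))))))
    where
    arith : ∀ z → (z ℤ.* ℤ.1ℤ ℤ.+ ℤ.1ℤ) ℤ.* ℤ.1ℤ ≡ ℤ.suc z ℤ.* ℤ.1ℤ
    arith z = cong (ℤ._* ℤ.1ℤ)
      (trans (cong (ℤ._+ ℤ.1ℤ) (ℤ.*-identityʳ z)) (ℤ.+-comm z ℤ.1ℤ))

  above : ℕ → ℤ → ℤ
  above ℕ.zero    z = ℤ.suc z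
  above (ℕ.suc k) z = above k (ℤ.suc z)

  search : ExcludedMiddle 0ℓ → ∀ x k z →
    fromℤ z ≤ x → x < fromℤ (above k z) → ∃[ z ] z IsFloorOf x
  search em x ℕ.zero    z z≤x x<z = z , z≤x , x<z
  search em x (ℕ.suc k) z z≤x x<z with em {x < fromℤ (ℤ.suc z)}
  ... | yes x<1+z = z , z≤x , x<1+z
  ... | no  x≮1+z = search em x k (ℤ.suc z) (≮⇒≥ x (ℤ.suc z ℚ./ 1) x≮1+z) x<z

floor-exists : ExcludedMiddle 0ℓ → ∀ x → ∃[ z ] z IsFloorOf x
floor-exists em x = search em x 3 z z≤x x<z+4
  where
  0<1 : 0ℚ ℚ.< 1ℚ
  0<1 = ℚ.positive⁻¹ 1ℚ

  N     = proj₁ (cauchy x 1ℚ 0<1)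
  close = proj₂ (cauchy x 1ℚ 0<1)
  a     = seq x N
  z     = ℚ.floor (a ℚ.- 1ℚ)

  cancel : ∀ u v → (u ℚ.+ v) ℚ.- v ≡ u
  cancel = solve 2 (λ u v → (u :+ v) :- v := u) refl
    where open +-*-Solver

  cancel′ : ∀ u v → (u ℚ.- v) ℚ.+ v ≡ u
  cancel′ = solve 2 (λ u v → (u :- v) :+ v := u) refl
    where open +-*-Solver

  z≤x : fromℤ z ≤ x
  z≤x ε 0<ε = N , λ n N≤n → begin
    z ℚ./ 1                       ≤⟨ floor-≤ (a ℚ.- 1ℚ) ⟩
    a ℚ.- 1ℚ                      ≤⟨ ℚ.+-monoˡ-≤ (ℚ.- 1ℚ) (abs-close a (seq x n) (close N n ℕ.≤-refl N≤n)) ⟩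
    (seq x n ℚ.+ 1ℚ) ℚ.- 1ℚ       ≡⟨ cancel (seq x n) 1ℚ ⟩
    seq x n                       ≡⟨ ℚ.+-identityʳ (seq x n) ⟨
    seq x n ℚ.+ 0ℚ                ≤⟨ ℚ.+-monoʳ-≤ (seq x n) (ℚ.<⇒≤ 0<ε) ⟩
    seq x n ℚ.+ ε                 ∎

  raise : ∀ {p} z → p ℚ.≤ z ℚ./ 1 → p ℚ.+ 1ℚ ℚ.≤ ℤ.suc z ℚ./ 1
  raise {p} z p≤z = subst (p ℚ.+ 1ℚ ℚ.≤_) (sym (suc-/1 z)) (ℚ.+-monoˡ-≤ 1ℚ p≤z)

  x<z+4 : x < fromℤ (above 3 z)
  x<z+4 = 1ℚ , 0<1 , N , λ n N≤n →
    raise (above 2 z) (ℚ.≤-trans (abs-close (seq x n) a (close n N N≤n ℕ.≤-refl))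
      (raise (above 1 z) (subst (ℚ._≤ above 1 z ℚ./ 1) (cancel′ a 1ℚ)
        (raise (above 0 z) (ℚ.<⇒≤ (<-suc-floor (a ℚ.- 1ℚ)))))))

module _ {c ℓ : Level} (G : AbelianGroup c ℓ) where
  open AbelianGroup G using (Carrier; _∙_; ε; _⁻¹) renaming (_≈_ to _≈ᴳ_)
  open Membership (AbelianGroup.setoid G) using (_∈_)

  data Span {p} (S : Pred Carrier p) : Pred Carrier (c ⊔ ℓ ⊔ p) where
    gen  : ∀ {x} → S x → Span S x
    unit : Span S ε
    mul  : ∀ {x y} → Span S x → Span S y → Span S (x ∙ y)
    inv  : ∀ {x} → Span S x → Span S (x ⁻¹)
    resp : ∀ {x y} → x ≈ᴳ y → Span S x → Span S y

  SpansFinitelyGenerated : ∀ {p} → Pred Carrier p → Set (c ⊔ ℓ ⊔ p)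
  SpansFinitelyGenerated S = ∃[ gs ] Span S ≐ Span (_∈ gs)

sequences : AbelianGroup 0ℓ 0ℓ
sequences = Pointwise.abelianGroup ℕ ℤ.+-0-abelianGroup

Kernel : ℕ → (ℕ → ℤ) → Pred (ℕ → ℤ) 0ℓ
Kernel k a b = ∃[ l ] ∃[ r ] r ℕ.< k ℕ.^ l × b ≗ (λ n → a (k ℕ.^ l ℕ.* n ℕ.+ r))

_-Regular_ : ℕ → (ℕ → ℤ) → Set
k -Regular a = SpansFinitelyGenerated sequences (Kernel k a)

Regular : (ℕ → ℤ) → Set
Regular a = ∃[ k ] 2 ℕ.≤ k × k -Regular a

{-# OPTIONS --safe #-}

-- If f is k-regular, the sequences f(kˡ n), l ≥ 0, lie in a finitely generated
-- group, so a linear dependence among them is a recurrence for a(l) = f(kˡ).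
-- A convergent rational sequence satisfying a linear recurrence over ℚ has
-- a rational limit.  For p(x) = c + x p′(x), the sequence a(l) / kˡ again satisfies
-- a recurrence and is asymptotic to p′(kˡ); so, going down the coefficient list,
-- the coefficients of p′ are rational, and once those of higher degree have been
-- subtracted, each coefficient is such a limit.
--
-- Conversely, let q be the nonconstant part of p and D a common denominator of
-- its coefficients.  Then f − q has period D.  For a multiple k of D, the sequence
-- r ↦ f(kˡ n + r), l ≥ 1, is annihilated by a power of E^D − 1, and
-- l ↦ f(kˡ⁺¹ n + r) by (E − 1)(E − k)⋯(E − k^d).  These operators are monic, so
-- finitely many members of the kernel generate all the others.
module Submission where

open import Defs hiding (_+_; _*_; _≤_; _<_)
open import Algebra.Bundles using (AbelianGroup)
open import Data.Fin.Base using (Fin; zero; suc; punchIn; punchOut)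
import Data.Fin.Properties as Fin
import Data.Integer.Base as ℤ
import Data.Integer.Properties as ℤ
open import Data.Integer.Base using (ℤ)
open import Data.List.Base
  using (List; []; _∷_; _++_; cartesianProductWith; drop; foldr; length; map; replicate; upTo)
import Data.List.Membership.Propositional.Properties as ∈ₚ
import Data.List.Membership.Setoid as Membership
import Data.List.Properties as List
open import Data.List.Relation.Unary.All as All using (All; []; _∷_)
import Data.List.Relation.Unary.All.Properties as All
open import Data.List.Relation.Unary.Any as Any using (here; there)
import Data.Nat.Base as ℕ
import Data.Nat.Properties as ℕ
import Data.Nat.Solver as ℕ
open import Data.Nat.Base using (ℕ; zero; suc)
open import Data.Product.Base using (∃-syntax; _×_; _,_; proj₁; proj₂)
open import Data.Rational.Base as ℚ
  using (ℚ; 0ℚ; 1ℚ; ½; ∣_∣; _+_; _*_; _-_; -_; _≤_; _<_; 1/_)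
import Data.Rational.Properties as ℚ
open import Data.Rational.Solver using (module +-*-Solver)
import Data.Rational.Unnormalised.Base as ℚᵘ
import Data.Rational.Unnormalised.Properties as ℚᵘ
open import Data.Sum.Base using (inj₁; inj₂)
open import Function.Base using (_∘_)
open import Function.Bundles using (_⇔_; mk⇔)
open import Level using (0ℓ)
open import Relation.Binary.PropositionalEquality hiding (resp)
open import Relation.Nullary using (¬_; yes; no; contradiction)
open import Relation.Unary using (Pred)
open +-*-Solver using (solve; _:=_; _:+_; _:*_; _:-_; :-_; con)
open Membership (AbelianGroup.setoid sequences) using (_∈_)

-- Integers as rational numbers

ι : ℤ → ℚ
ι z = z ℚ./ 1


toℚᵘ-ι : ∀ z → ℚ.toℚᵘ (ι z) ℚᵘ.≃ ℚᵘ.mkℚᵘ z 0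
toℚᵘ-ι z = ℚ.toℚᵘ-fromℚᵘ (ℚᵘ.mkℚᵘ z 0)

ι-+ : ∀ y z → ι (y ℤ.+ z) ≡ ι y + ι z
ι-+ y z = ℚ.toℚᵘ-injective (ℚᵘ.≃-trans (toℚᵘ-ι (y ℤ.+ z)) (ℚᵘ.≃-sym
  (ℚᵘ.≃-trans (ℚ.toℚᵘ-homo-+ (ι y) (ι z)) (ℚᵘ.≃-trans (ℚᵘ.+-cong (toℚᵘ-ι y) (toℚᵘ-ι z))
    (ℚᵘ.*≡* (cong (ℤ._* ℤ.1ℤ) (cong₂ ℤ._+_ (ℤ.*-identityʳ y) (ℤ.*-identityʳ z))))))))

ι-* : ∀ y z → ι (y ℤ.* z) ≡ ι y * ι z
ι-* y z = ℚ.toℚᵘ-injective (ℚᵘ.≃-trans (toℚᵘ-ι (y ℤ.* z)) (ℚᵘ.≃-sym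
  (ℚᵘ.≃-trans (ℚ.toℚᵘ-homo-* (ι y) (ι z)) (ℚᵘ.*-cong (toℚᵘ-ι y) (toℚᵘ-ι z)))))

ι-neg : ∀ z → ι (ℤ.- z) ≡ - ι z
ι-neg z = ℚ.toℚᵘ-injective (ℚᵘ.≃-trans (toℚᵘ-ι (ℤ.- z)) (ℚᵘ.≃-sym
  (ℚᵘ.≃-trans (ℚ.toℚᵘ-homo‿- (ι z)) (ℚᵘ.-‿cong (toℚᵘ-ι z)))))

ι-- : ∀ y z → ι (y ℤ.- z) ≡ ι y - ι z
ι-- y z = trans (ι-+ y (ℤ.- z)) (cong (ι y +_) (ι-neg z))

ι-mono-≤ : ∀ {y z} → y ℤ.≤ z → ι y ≤ ι z
ι-mono-≤ {y} {z} y≤z = ℚ.toℚᵘ-cancel-≤ (ℚᵘ.≤-respˡ-≃ (ℚᵘ.≃-sym (toℚᵘ-ι y))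
  (ℚᵘ.≤-respʳ-≃ (ℚᵘ.≃-sym (toℚᵘ-ι z)) (ℚᵘ.*≤* (ℤ.*-monoʳ-≤-nonNeg ℤ.1ℤ y≤z))))

ι-cancel-< : ∀ {y z} → ι y < ι z → y ℤ.< z
ι-cancel-< {y} {z} y<z = ℤ.*-cancelʳ-<-nonNeg ℤ.1ℤ (ℚᵘ.drop-*<*
  (ℚᵘ.<-respˡ-≃ (toℚᵘ-ι y) (ℚᵘ.<-respʳ-≃ (toℚᵘ-ι z) (ℚ.toℚᵘ-mono-< y<z))))

ι-injective : ∀ {y z} → ι y ≡ ι z → y ≡ z
ι-injective {y} {z} eq = ℤ.*-cancelʳ-≡ y z ℤ.1ℤ (ℚᵘ.drop-*≡*
  (ℚᵘ.≃-trans (ℚᵘ.≃-sym (toℚᵘ-ι y)) (ℚᵘ.≃-trans (ℚᵘ.≃-reflexive (cong ℚ.toℚᵘ eq)) (toℚᵘ-ι z))))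

p-q≡0⇒p≡q : ∀ {p q} → p - q ≡ 0ℚ → p ≡ q
p-q≡0⇒p≡q {p} {q} eq = trans (solve 2 (λ p q → p := (p :- q) :+ q) refl p q)
  (trans (cong (_+ q) eq) (ℚ.+-identityˡ q))

*-cancelˡ-0 : ∀ p q r → r * p ≡ 1ℚ → p * q ≡ 0ℚ → q ≡ 0ℚ
*-cancelˡ-0 p q r rp≡1 pq≡0 = begin
  q            ≡⟨ ℚ.*-identityˡ q ⟨
  1ℚ * q       ≡⟨ cong (_* q) rp≡1 ⟨
  r * p * q    ≡⟨ ℚ.*-assoc r p q ⟩
  r * (p * q)  ≡⟨ cong (r *_) pq≡0 ⟩
  r * 0ℚ       ≡⟨ ℚ.*-zeroʳ r ⟩
  0ℚ           ∎
  where open ≡-Reasoning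

-- Linear recurrences with constant rational coefficients

-- χ(E) a, for the polynomial χ with coefficients listed from the constant
-- term up and the shift operator E.
act : List ℚ → (ℕ → ℚ) → ℕ → ℚ
act []      a n = 0ℚ
act (c ∷ χ) a n = c * a n + act χ a (suc n)

act-cong : ∀ χ {a b} → a ≗ b → act χ a ≗ act χ b
act-cong []      a≗b n = refl
act-cong (c ∷ χ) a≗b n = cong₂ _+_ (cong (c *_) (a≗b n)) (act-cong χ a≗b (suc n))

act-+ : ∀ χ a b n → act χ (λ i → a i + b i) n ≡ act χ a n + act χ b n
act-+ []      a b n = refl
act-+ (c ∷ χ) a b n = trans (cong (c * (a n + b n) +_) (act-+ χ a b (suc n)))
  (solve 5 (λ c x y u v → c :* (x :+ y) :+ (u :+ v) := (c :* x :+ u) :+ (c :* y :+ v)) refl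
    c (a n) (b n) (act χ a (suc n)) (act χ b (suc n)))

act-* : ∀ χ q a n → act χ (λ i → q * a i) n ≡ q * act χ a n
act-* []      q a n = sym (ℚ.*-zeroʳ q)
act-* (c ∷ χ) q a n = trans (cong (c * (q * a n) +_) (act-* χ q a (suc n)))
  (solve 4 (λ c q x u → c :* (q :* x) :+ q :* u := q :* (c :* x :+ u)) refl
    c q (a n) (act χ a (suc n)))

act-map-* : ∀ q χ a n → act (map (q *_) χ) a n ≡ q * act χ a n
act-map-* q []      a n = sym (ℚ.*-zeroʳ q)
act-map-* q (c ∷ χ) a n = trans (cong (q * c * a n +_) (act-map-* q χ a (suc n)))
  (solve 4 (λ c q x u → (q :* c) :* x :+ q :* u := q :* (c :* x :+ u)) refl
    c q (a n) (act χ a (suc n)))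

act-zero : ∀ χ n → act χ (λ _ → 0ℚ) n ≡ 0ℚ
act-zero χ n = trans (act-* χ 0ℚ (λ _ → 0ℚ) n) (ℚ.*-zeroˡ (act χ (λ _ → 0ℚ) n))

act-suc : ∀ χ a n → act χ a (suc n) ≡ act χ (a ∘ suc) n
act-suc []      a n = refl
act-suc (c ∷ χ) a n = cong (c * a (suc n) +_) (act-suc χ a (suc n))

-- Coefficient lists may end in zeros, so a nonzero operator is one with some nonzero coefficient,
-- not a nonempty list.
Zero : List ℚ → Set
Zero = All (_≡ 0ℚ)

Recurrent : (ℕ → ℚ) → Set
Recurrent a = ∃[ χ ] ¬ Zero χ × (∀ n → act χ a n ≡ 0ℚ)

Recurrent-cong : ∀ {a b} → a ≗ b → Recurrent b → Recurrent a
Recurrent-cong a≗b (χ , χ≢0 , χb) = χ , χ≢0 , λ n → trans (act-cong χ a≗b n) (χb n)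


-- The coefficients of c + (E − 1) χ(E).
timesΔ : ℚ → List ℚ → List ℚ
timesΔ c []      = c ∷ []
timesΔ c (b ∷ χ) = (c - b) ∷ timesΔ b χ

act-timesΔ : ∀ c χ a n → act (timesΔ c χ) a n ≡ c * a n + (act χ a (suc n) - act χ a n)
act-timesΔ c []      a n = refl
act-timesΔ c (b ∷ χ) a n = trans (cong ((c - b) * a n +_) (act-timesΔ b χ a (suc n)))
  (solve 6 (λ c b x y u v → (c :- b) :* x :+ (b :* y :+ (u :- v)) :=
                            c :* x :+ ((b :* y :+ u) :- (b :* x :+ v))) refl
    c b (a n) (a (suc n)) (act χ a (suc (suc n))) (act χ a (suc n)))

-- Neighbouring coefficients agree and the last one is zero, so zero spreads back from the end of
-- the list.
timesΔ-Zero : ∀ c χ → Zero (timesΔ c χ) → c ≡ 0ℚ × Zero χ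
timesΔ-Zero c []      (c≡0 ∷ [])     = c≡0 , []
timesΔ-Zero c (b ∷ χ) (c-b≡0 ∷ zs) =
  let b≡0 , χ≡0 = timesΔ-Zero b χ zs in trans (p-q≡0⇒p≡q c-b≡0) b≡0 , b≡0 ∷ χ≡0

-- E - 1 kills the constant `q`, so (E - 1) χ(E) kills `a` and `q` alike.
Recurrent-translate : ∀ q {a} → Recurrent a → Recurrent (λ n → a n - q)
Recurrent-translate q {a} (χ , χ≢0 , χa) = timesΔ 0ℚ χ , χ≢0 ∘ proj₂ ∘ timesΔ-Zero 0ℚ χ , λ n → begin
  act (timesΔ 0ℚ χ) a′ n                        ≡⟨ act-timesΔ 0ℚ χ a′ n ⟩
  0ℚ * a′ n + (act χ a′ (suc n) - act χ a′ n)   ≡⟨ cong (λ x → 0ℚ * a′ n + (x - act χ a′ n)) (act-suc χ a′ n) ⟩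
  0ℚ * a′ n + (act χ (a′ ∘ suc) n - act χ a′ n)
    ≡⟨ cong₂ (λ x y → 0ℚ * a′ n + (x - y)) (act-+ χ (a ∘ suc) (λ _ → - q) n) (act-+ χ a (λ _ → - q) n) ⟩
  0ℚ * a′ n + ((act χ (a ∘ suc) n + act χ (λ _ → - q) n) - (act χ a n + act χ (λ _ → - q) n))
    ≡⟨ cong₂ (λ x y → 0ℚ * a′ n + ((x + act χ (λ _ → - q) n) - (y + act χ (λ _ → - q) n)))
         (trans (sym (act-suc χ a n)) (χa (suc n))) (χa n) ⟩
  0ℚ * a′ n + ((0ℚ + act χ (λ _ → - q) n) - (0ℚ + act χ (λ _ → - q) n))
    ≡⟨ solve 2 (λ x y → con 0ℚ :* x :+ ((con 0ℚ :+ y) :- (con 0ℚ :+ y)) := con 0ℚ) refl (a′ n) (act χ (λ _ → - q) n) ⟩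
  0ℚ ∎
  where
  open ≡-Reasoning
  a′ = λ n → a n - q

pow : ℚ → ℕ → ℚ
pow v zero    = 1ℚ
pow v (suc n) = v * pow v n

pow-inverse : ∀ w v → w * v ≡ 1ℚ → ∀ n → pow w n * pow v n ≡ 1ℚ
pow-inverse w v wv≡1 zero    = refl
pow-inverse w v wv≡1 (suc n) = begin
  w * pow w n * (v * pow v n)    ≡⟨ solve 4 (λ w x v y → w :* x :* (v :* y) := w :* v :* (x :* y)) refl w (pow w n) v (pow v n) ⟩
  w * v * (pow w n * pow v n)    ≡⟨ cong₂ _*_ wv≡1 (pow-inverse w v wv≡1 n) ⟩
  1ℚ                             ∎
  where open ≡-Reasoning

-- The coefficients of χ(w E).
dilate : ℚ → List ℚ → List ℚ
dilate w []      = []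
dilate w (c ∷ χ) = c ∷ map (w *_) (dilate w χ)

-- Each shift brings out a factor v from `pow v`, and the w attached to E cancels it.
act-dilate : ∀ w v → w * v ≡ 1ℚ → ∀ χ a n →
             act (dilate w χ) (λ i → pow v i * a i) n ≡ pow v n * act χ a n
act-dilate w v wv≡1 []      a n = sym (ℚ.*-zeroʳ (pow v n))
act-dilate w v wv≡1 (c ∷ χ) a n = begin
  c * (y * a n) + act (map (w *_) (dilate w χ)) b (suc n)
    ≡⟨ cong (c * (y * a n) +_) (act-map-* w (dilate w χ) b (suc n)) ⟩
  c * (y * a n) + w * act (dilate w χ) b (suc n)
    ≡⟨ cong (λ z → c * (y * a n) + w * z) (act-dilate w v wv≡1 χ a (suc n)) ⟩
  c * (y * a n) + w * (v * y * z)
    ≡⟨ solve 6 (λ c y x w v z → c :* (y :* x) :+ w :* (v :* y :* z) := c :* (y :* x) :+ w :* v :* (y :* z)) refl c y (a n) w v z ⟩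
  c * (y * a n) + w * v * (y * z)
    ≡⟨ cong (λ e → c * (y * a n) + e * (y * z)) wv≡1 ⟩
  c * (y * a n) + 1ℚ * (y * z)
    ≡⟨ solve 4 (λ c y x z → c :* (y :* x) :+ con 1ℚ :* (y :* z) := y :* (c :* x :+ z)) refl c y (a n) z ⟩
  y * (c * a n + z) ∎
  where
  open ≡-Reasoning
  b = λ i → pow v i * a i
  y = pow v n
  z = act χ a (suc n)

map-*-Zero : ∀ w v → v * w ≡ 1ℚ → ∀ χ → Zero (map (w *_) χ) → Zero χ
map-*-Zero w v vw≡1 []      []           = []
map-*-Zero w v vw≡1 (c ∷ χ) (wc≡0 ∷ zs) = *-cancelˡ-0 w c v vw≡1 wc≡0 ∷ map-*-Zero w v vw≡1 χ zs

dilate-Zero : ∀ w v → v * w ≡ 1ℚ → ∀ χ → Zero (dilate w χ) → Zero χ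
dilate-Zero w v vw≡1 []      []           = []
dilate-Zero w v vw≡1 (c ∷ χ) (c≡0 ∷ zs) =
  c≡0 ∷ dilate-Zero w v vw≡1 χ (map-*-Zero w v vw≡1 (dilate w χ) zs)

Recurrent-scale : ∀ w v → w * v ≡ 1ℚ → ∀ {a} → Recurrent a → Recurrent (λ n → pow v n * a n)
Recurrent-scale w v wv≡1 {a} (χ , χ≢0 , χa) =
  dilate w χ , χ≢0 ∘ dilate-Zero w v (trans (ℚ.*-comm v w) wv≡1) χ , λ n →
    trans (act-dilate w v wv≡1 χ a n) (trans (cong (pow v n *_) (χa n)) (ℚ.*-zeroʳ (pow v n)))

total : List ℚ → ℚ
total = foldr _+_ 0ℚ

total-Zero : ∀ {χ} → Zero χ → total χ ≡ 0ℚ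
total-Zero []          = refl
total-Zero (refl ∷ zs) = trans (ℚ.+-identityˡ _) (total-Zero zs)

-- The suffix sums of χ are the coefficients of the quotient of b + E χ(E)
-- by E − 1.
suffixSums : List ℚ → List ℚ
suffixSums []      = []
suffixSums (c ∷ χ) = total (c ∷ χ) ∷ suffixSums χ

length-suffixSums : ∀ χ → length (suffixSums χ) ≡ length χ
length-suffixSums []      = refl
length-suffixSums (c ∷ χ) = cong suc (length-suffixSums χ)

-- Division with remainder by E - 1. The remainder is the value at E = 1, which is the sum of the
-- coefficients.
act-suffixSums : ∀ b χ a n → act (b ∷ χ) a n ≡
  (act (suffixSums χ) a (suc n) - act (suffixSums χ) a n) + total (b ∷ χ) * a n
act-suffixSums b []      a n =
  solve 2 (λ b x → b :* x :+ con 0ℚ := (con 0ℚ :- con 0ℚ) :+ (b :+ con 0ℚ) :* x) refl b (a n)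
act-suffixSums b (c ∷ χ) a n = trans (cong (b * a n +_) (act-suffixSums c χ a (suc n)))
  (solve 6 (λ b x y t u v → b :* x :+ ((u :- v) :+ t :* y) :=
                            ((t :* y :+ u) :- (t :* x :+ v)) :+ (b :+ t) :* x) refl
    b (a n) (a (suc n)) (total (c ∷ χ))
    (act (suffixSums χ) a (suc (suc n))) (act (suffixSums χ) a (suc n)))

suffixSums-Zero : ∀ χ → Zero (suffixSums χ) → Zero χ
suffixSums-Zero []      []         = []
suffixSums-Zero (c ∷ χ) (t≡0 ∷ zs) = trans (sym (ℚ.+-identityʳ c))
  (trans (cong (c +_) (sym (total-Zero χ≡0))) t≡0) ∷ χ≡0
  where χ≡0 = suffixSums-Zero χ zs

-- Null sequences and limits

½ε+½ε≡ε : ∀ ε → ½ * ε + ½ * ε ≡ ε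
½ε+½ε≡ε ε = trans (sym (ℚ.*-distribʳ-+ ε ½ ½)) (ℚ.*-identityˡ ε)

½ε>0 : ∀ {ε} → 0ℚ < ε → 0ℚ < ½ * ε
½ε>0 0<ε = ℚ.*-monoʳ-<-pos ½ 0<ε

p≤∣p∣ : ∀ p → p ≤ ∣ p ∣
p≤∣p∣ p with ℚ.≤-total 0ℚ p
... | inj₁ 0≤p = ℚ.≤-reflexive (sym (ℚ.0≤p⇒∣p∣≡p 0≤p))
... | inj₂ p≤0 = ℚ.≤-trans p≤0 (ℚ.0≤∣p∣ p)

*-mono-≤-nonNeg : ∀ p q r s → 0ℚ ≤ r → 0ℚ ≤ q → p ≤ q → r ≤ s → p * r ≤ q * s
*-mono-≤-nonNeg p q r s 0≤r 0≤q p≤q r≤s = ℚ.≤-trans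
  (ℚ.*-monoʳ-≤-nonNeg r {{ℚ.nonNegative 0≤r}} p≤q)
  (ℚ.*-monoˡ-≤-nonNeg q {{ℚ.nonNegative 0≤q}} r≤s)

quotient>0 : ∀ B ε → 0ℚ < B → 0ℚ < ε → ∃[ δ ] 0ℚ < δ × B * δ ≡ ε
quotient>0 B ε 0<B 0<ε = 1/ B * ε , ℚ.positive⁻¹ (1/ B * ε) ,
  trans (sym (ℚ.*-assoc B (1/ B) ε)) (trans (cong (_* ε) (ℚ.*-inverseʳ B)) (ℚ.*-identityˡ ε))
  where
  instance
    B>0 = ℚ.positive 0<B
    B≢0 = ℚ.pos⇒nonZero B
    ε>0 = ℚ.positive 0<ε
    1/B>0 = ℚ.1/pos⇒pos B
    δ>0 = ℚ.pos*pos⇒pos (1/ B) ε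

Null : (ℕ → ℚ) → Set
Null s = ∀ ε → 0ℚ < ε → ∃[ N ] ∀ n → N ℕ.≤ n → ∣ s n ∣ ≤ ε

Null-cong : ∀ {s t} → s ≗ t → Null t → Null s
Null-cong s≗t null ε 0<ε = let N , small = null ε 0<ε in
  N , λ n N≤n → subst (λ p → ∣ p ∣ ≤ ε) (sym (s≗t n)) (small n N≤n)

Null-0 : Null (λ _ → 0ℚ)
Null-0 ε 0<ε = 0 , λ _ _ → ℚ.<⇒≤ 0<ε

Null-+ : ∀ {s t} → Null s → Null t → Null (λ n → s n + t n)
Null-+ {s} {t} null-s null-t ε 0<ε =
  let M , small-s = null-s (½ * ε) (½ε>0 0<ε)
      N , small-t = null-t (½ * ε) (½ε>0 0<ε)
  in M ℕ.⊔ N , λ n ≤n → begin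
    ∣ s n + t n ∣      ≤⟨ ℚ.∣p+q∣≤∣p∣+∣q∣ (s n) (t n) ⟩
    ∣ s n ∣ + ∣ t n ∣  ≤⟨ ℚ.+-mono-≤ (small-s n (ℕ.m⊔n≤o⇒m≤o M N ≤n)) (small-t n (ℕ.m⊔n≤o⇒n≤o M N ≤n)) ⟩
    ½ * ε + ½ * ε      ≡⟨ ½ε+½ε≡ε ε ⟩
    ε                  ∎
  where open ℚ.≤-Reasoning

Null-* : ∀ q {s} → Null s → Null (λ n → q * s n)
Null-* q {s} null ε 0<ε =
  -- The bound is divided by below, and `q` may be zero; hence the extra 1.
  let B = ∣ q ∣ + 1ℚ
      0<B = ℚ.+-mono-≤-< (ℚ.0≤∣p∣ q) (ℚ.positive⁻¹ 1ℚ)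
      δ , 0<δ , Bδ≡ε = quotient>0 B ε 0<B 0<ε
      N , small = null δ 0<δ
  in N , λ n N≤n → begin
    ∣ q * s n ∣      ≡⟨ ℚ.∣p*q∣≡∣p∣*∣q∣ q (s n) ⟩
    ∣ q ∣ * ∣ s n ∣  ≤⟨ *-mono-≤-nonNeg (∣ q ∣) B (∣ s n ∣) δ (ℚ.0≤∣p∣ (s n)) (ℚ.<⇒≤ 0<B)
                         (subst (_≤ B) (ℚ.+-identityʳ (∣ q ∣)) (ℚ.+-monoʳ-≤ (∣ q ∣) (ℚ.nonNegative⁻¹ 1ℚ)))
                         (small n N≤n) ⟩
    B * δ            ≡⟨ Bδ≡ε ⟩
    ε                ∎
  where open ℚ.≤-Reasoning

Null-suc : ∀ {s} → Null s → Null (s ∘ suc)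
Null-suc null ε 0<ε = let N , small = null ε 0<ε in
  N , λ n N≤n → small (suc n) (ℕ.m≤n⇒m≤1+n N≤n)

Null-const : ∀ {q} → Null (λ _ → q) → q ≡ 0ℚ
Null-const {q} null with q ℚ.≟ 0ℚ
... | yes q≡0 = q≡0
... | no  q≢0 = contradiction (ℚ.<-≤-trans ε<∣q∣ (proj₂ (null ε 0<ε) _ ℕ.≤-refl)) (ℚ.<-irrefl refl)
  where
  0<∣q∣ : 0ℚ < ∣ q ∣
  0<∣q∣ = ℚ.≰⇒> λ ∣q∣≤0 → q≢0 (ℚ.∣p∣≡0⇒p≡0 q (ℚ.≤-antisym ∣q∣≤0 (ℚ.0≤∣p∣ q)))
  ε = proj₁ (ℚ.<-dense 0<∣q∣)
  0<ε = proj₁ (proj₂ (ℚ.<-dense 0<∣q∣))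
  ε<∣q∣ = proj₂ (proj₂ (ℚ.<-dense 0<∣q∣))

Null-seq-Δ : ∀ x → Null (λ n → seq x (suc n) - seq x n)
Null-seq-Δ x ε 0<ε = let N , close = cauchy x ε 0<ε in
  N , λ n N≤n → close (suc n) n (ℕ.m≤n⇒m≤1+n N≤n) N≤n

-- On a convergent sequence the shift acts as the identity in the limit, so χ(E) a tends to χ(1)
-- times the limit. `Null-seq-Δ` exchanges the shifted representative of the limit for the unshifted
-- one.
act-limit : ∀ a x → Null (λ n → a n - seq x n) →
            ∀ χ → Null (λ n → act χ a n - total χ * seq x n)
act-limit a x a→x [] = Null-cong (λ n → solve 1 (λ x → con 0ℚ :- con 0ℚ :* x := con 0ℚ) refl (seq x n)) Null-0
act-limit a x a→x (c ∷ χ) = Null-cong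
  (λ n → solve 6 (λ c a x y t u → (c :* a :+ u) :- (c :+ t) :* x :=
                                  (c :* (a :- x) :+ (u :- t :* y)) :+ t :* (y :- x)) refl
     c (a n) (seq x n) (seq x (suc n)) (total χ) (act χ a (suc n)))
  (Null-+ (Null-+ (Null-* c a→x) (Null-suc (act-limit a x a→x χ))) (Null-* (total χ) (Null-seq-Δ x)))

-- If χ(1) ≠ 0, the limit is c / χ(1); otherwise c = 0, and χ can be divided
-- by E − 1.
limit-rational : ∀ m χ → length χ ≡ m → ¬ Zero χ → ∀ a x c →
  (∀ n → act χ a n ≡ c) → Null (λ n → a n - seq x n) → IsRational x
limit-rational m       []      _    χ≢0 a x c _ _ = contradiction [] χ≢0
limit-rational (suc m) (b ∷ χ) len χ≢0 a x c χa≡c a→x with total (b ∷ χ) ℚ.≟ 0ℚ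
... | no t≢0 = u * c , Null-cong
  (λ n → trans (cong₂ _-_ (trans (sym (ℚ.*-identityʳ (seq x n))) (cong (seq x n *_) (sym (ℚ.*-inverseˡ t)))) refl)
    (solve 4 (λ x u t c → x :* (u :* t) :- u :* c := (:- u) :* (c :- t :* x)) refl (seq x n) u t c))
  (Null-* (- u) (Null-cong (λ n → cong (_- t * seq x n) (sym (χa≡c n))) (act-limit a x a→x (b ∷ χ))))
  where
  t = total (b ∷ χ)
  instance t≠0 = ℚ.≢-nonZero t≢0
  u = 1/ t
-- After the division ψ(E) a is constant but perhaps not zero, which is why the statement allows any
-- `c`. The recursion runs on the length because `ψ` is not a sublist of `χ`.
... | yes t≡0 = limit-rational m ψ (trans (length-suffixSums χ) (ℕ.suc-injective len)) ψ≢0 a x (act ψ a 0) ψa≡ a→x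
  where
  ψ = suffixSums χ

  ψ≢0 : ¬ Zero ψ
  ψ≢0 ψ≡0 = χ≢0 (trans (sym (ℚ.+-identityʳ b)) (trans (cong (b +_) (sym (total-Zero χ≡0))) t≡0) ∷ χ≡0)
    where χ≡0 = suffixSums-Zero χ ψ≡0

  t*≡0 : ∀ p → total (b ∷ χ) * p ≡ 0ℚ
  t*≡0 p = trans (cong (_* p) t≡0) (ℚ.*-zeroˡ p)

  c≡0 : c ≡ 0ℚ
  c≡0 = Null-const (Null-cong
    (λ n → trans (sym (χa≡c n)) (trans (sym (ℚ.+-identityʳ _))
      (cong (λ z → act (b ∷ χ) a n - z) (sym (t*≡0 (seq x n))))))
    (act-limit a x a→x (b ∷ χ)))

  Δψa≡0 : ∀ n → act ψ a (suc n) - act ψ a n ≡ 0ℚ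
  Δψa≡0 n = begin
    d                                   ≡⟨ ℚ.+-identityʳ d ⟨
    d + 0ℚ                              ≡⟨ cong (d +_) (t*≡0 (a n)) ⟨
    d + total (b ∷ χ) * a n             ≡⟨ act-suffixSums b χ a n ⟨
    act (b ∷ χ) a n                     ≡⟨ trans (χa≡c n) c≡0 ⟩
    0ℚ                                  ∎
    where
    open ≡-Reasoning
    d = act ψ a (suc n) - act ψ a n

  ψa≡ : ∀ n → act ψ a n ≡ act ψ a 0
  ψa≡ zero    = refl
  ψa≡ (suc n) = trans (p-q≡0⇒p≡q (Δψa≡0 n)) (ψa≡ n)

q*↧q≡↥q : ∀ q → q * ι (ℚ.↧ q) ≡ ι (ℚ.↥ q)
q*↧q≡↥q q@(ℚ.mkℚ n d-1 _) = ℚ.toℚᵘ-injective (ℚᵘ.≃-trans (ℚ.toℚᵘ-homo-* q (ι (ℚ.↧ q)))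
  (ℚᵘ.≃-trans (ℚᵘ.*-congˡ {ℚ.toℚᵘ q} (toℚᵘ-ι (ℚ.↧ q)))
    (ℚᵘ.≃-trans (ℚᵘ.*≡* (trans (ℤ.*-identityʳ _) (cong (n ℤ.*_) (cong (ℤ.+_ ∘ suc) (sym (ℕ.*-identityʳ d-1))))))
      (ℚᵘ.≃-sym (toℚᵘ-ι n)))))

1≤↥ε : ∀ ε → 0ℚ < ε → ℤ.1ℤ ℤ.≤ ℚ.↥ ε
1≤↥ε ε@record{} 0<ε = ℤ.i<j⇒suc[i]≤j (ℤ.positive⁻¹ (ℚ.↥ ε) {{ℚ.positive 0<ε}})

∣p∣≤q : ∀ p {q} → p ≤ q → - p ≤ q → ∣ p ∣ ≤ q
∣p∣≤q p {q} p≤q -p≤q with ℚ.∣p∣≡p∨∣p∣≡-p p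
... | inj₁ eq = subst (_≤ q) (sym eq) p≤q
... | inj₂ eq = subst (_≤ q) (sym eq) -p≤q

-- Real polynomials at rational points

evalℚ : List ℚ → ℚ → ℚ
evalℚ qs t = foldr (λ q v → q + t * v) 0ℚ qs

coefficients : ∀ {p} → All IsRational p → List ℚ
coefficients = All.reduce proj₁

-- The sequence of rationals representing p(t).
evalSeq : Polynomial → ℚ → ℕ → ℚ
evalSeq p t n = foldr (λ c v → seq c n + t * v) 0ℚ p

seq-eval : ∀ p m n → seq (eval p (fromℕ m)) n ≡ evalSeq p (ι (ℤ.+ m)) n
seq-eval []      m n = refl
seq-eval (c ∷ p) m n = cong (λ v → seq c n + ι (ℤ.+ m) * v) (seq-eval p m n)

evalSeq-≈ : ∀ {p} (r : All IsRational p) t → Null (λ n → evalSeq p t n - evalℚ (coefficients r) t)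
evalSeq-≈ {[]}    []              t = Null-cong {t = λ _ → 0ℚ} (λ _ → refl) Null-0
evalSeq-≈ {c ∷ p} ((q , c≈q) ∷ r) t = Null-cong
  (λ n → solve 5 (λ c t e q s → (c :+ t :* e) :- (q :+ t :* s) := (c :- q) :+ t :* (e :- s)) refl
    (seq c n) t (evalSeq p t n) q (evalℚ (coefficients r) t))
  (Null-+ c≈q (Null-* t (evalSeq-≈ r t)))

seq-bounded : ∀ x → ∃[ B ] ∃[ N ] ∀ n → N ℕ.≤ n → ∣ seq x n ∣ ≤ B
seq-bounded x with cauchy x 1ℚ (ℚ.positive⁻¹ 1ℚ)
... | N , close = ∣ a ∣ + 1ℚ , N , λ n N≤n → begin
    ∣ seq x n ∣              ≡⟨ cong ∣_∣ (solve 2 (λ u v → u := v :+ (u :- v)) refl (seq x n) a) ⟩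
    ∣ a + (seq x n - a) ∣    ≤⟨ ℚ.∣p+q∣≤∣p∣+∣q∣ a (seq x n - a) ⟩
    ∣ a ∣ + ∣ seq x n - a ∣  ≤⟨ ℚ.+-monoʳ-≤ (∣ a ∣) (close n N N≤n ℕ.≤-refl) ⟩
    ∣ a ∣ + 1ℚ               ∎
  where
  open ℚ.≤-Reasoning
  a = seq x N

Near : ℚ → (ℕ → ℚ) → ℚ → Set
Near q x ε = ∃[ M ] ∀ m → M ℕ.≤ m → ∣ q - x m ∣ ≤ ε

-- Asymptotics along the powers of κ, with inverse ω

module Powers (κ ω : ℚ) (ω*κ≡1 : ω * κ ≡ 1ℚ) (ω→0 : Null (pow ω)) where

  ω^l*κ^l≡1 : ∀ l → pow ω l * pow κ l ≡ 1ℚ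
  ω^l*κ^l≡1 = pow-inverse ω κ ω*κ≡1

  -- The index from which the representatives of p(κ^l) satisfy the bound may depend on `l`.
  NearPowers : (ℕ → ℚ) → Polynomial → ℚ → Set
  NearPowers a p ε = ∃[ N ] ∀ l → N ℕ.≤ l → Near (a l) (evalSeq p (pow κ l)) ε

  Converges : (ℕ → ℚ) → Polynomial → Set
  Converges a p = ∀ ε → 0ℚ < ε → NearPowers a p ε

  -- Dividing a(l) ≈ c + κ^l p(κ^l) by κ^l leaves an error of at most (B + C) ω^l, where `C` bounds
  -- c. A bounded error thus becomes a vanishing one, and the constant term disappears.
  divide-step : ∀ a c p {B} → NearPowers a (c ∷ p) B → Converges (λ l → pow ω l * a l) p
  divide-step a c p {B} (N , near) ε 0<ε =
    let C , M , c≤C = seq-bounded c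
        N′ , small = Null-* (B + C) ω→0 ε 0<ε
    in N ℕ.⊔ N′ , λ l ≤l →
    let M′ , close = near l (ℕ.m⊔n≤o⇒m≤o N N′ ≤l)
        w = pow ω l
        e = evalSeq p (pow κ l)
    in M ℕ.⊔ M′ , λ m ≤m → let d = a l - (seq c m + pow κ l * e m) in begin
      ∣ w * a l - e m ∣
        ≡⟨ cong ∣_∣ (trans (cong (λ z → w * a l - z) (trans (sym (ℚ.*-identityˡ (e m))) (cong (_* e m) (sym (ω^l*κ^l≡1 l)))))
             (solve 5 (λ w a c k e → w :* a :- w :* k :* e := w :* (a :- (c :+ k :* e)) :+ w :* c) refl
               w (a l) (seq c m) (pow κ l) (e m))) ⟩
      ∣ w * d + w * seq c m ∣
        ≤⟨ ℚ.∣p+q∣≤∣p∣+∣q∣ (w * d) (w * seq c m) ⟩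
      ∣ w * d ∣ + ∣ w * seq c m ∣
        ≡⟨ cong₂ _+_ (ℚ.∣p*q∣≡∣p∣*∣q∣ w d) (ℚ.∣p*q∣≡∣p∣*∣q∣ w (seq c m)) ⟩
      ∣ w ∣ * ∣ d ∣ + ∣ w ∣ * ∣ seq c m ∣
        ≡⟨ ℚ.*-distribˡ-+ (∣ w ∣) (∣ d ∣) (∣ seq c m ∣) ⟨
      ∣ w ∣ * (∣ d ∣ + ∣ seq c m ∣)
        ≤⟨ ℚ.*-monoˡ-≤-nonNeg (∣ w ∣) {{ℚ.∣-∣-nonNeg w}} (ℚ.≤-trans
             (ℚ.+-mono-≤ (close m (ℕ.m⊔n≤o⇒n≤o M M′ ≤m)) (c≤C m (ℕ.m⊔n≤o⇒m≤o M M′ ≤m)))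
             (p≤∣p∣ (B + C))) ⟩
      ∣ w ∣ * ∣ B + C ∣
        ≡⟨ trans (ℚ.*-comm (∣ w ∣) (∣ B + C ∣)) (sym (ℚ.∣p*q∣≡∣p∣*∣q∣ (B + C) w)) ⟩
      ∣ (B + C) * w ∣
        ≤⟨ small l (ℕ.m⊔n≤o⇒n≤o N N′ ≤l) ⟩
      ε ∎
    where open ℚ.≤-Reasoning

  -- The rational tail has the same real values as `p`, so subtracting it exactly leaves only the
  -- constant term in the limit.
  constant-limit : ∀ a c {p} (r : All IsRational p) → Converges a (c ∷ p) →
    Null (λ l → (a l - pow κ l * evalℚ (coefficients r) (pow κ l)) - seq c l)
  constant-limit a c {p} r a→ ε 0<ε =
    let h = ½ * ε
        0<h = ½ε>0 0<ε
        N , near = a→ h 0<h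
        M , close = cauchy c (½ * h) (½ε>0 0<h)
    in N ℕ.⊔ M , λ l ≤l →
    let N′ , near′ = near l (ℕ.m⊔n≤o⇒m≤o N M ≤l)
        M≤l = ℕ.m⊔n≤o⇒n≤o N M ≤l
        s = evalℚ (coefficients r) (pow κ l)
        e = evalSeq p (pow κ l)
        M′ , close′ = Null-* (pow κ l) (evalSeq-≈ r (pow κ l)) (½ * h) (½ε>0 0<h)
        -- An auxiliary index past all thresholds for this `l`; the Cauchy property of `c` leads
        -- from it back to the index `l`.
        m = N′ ℕ.⊔ (M ℕ.⊔ M′)
        M⊔M′≤m = ℕ.m⊔n≤o⇒n≤o N′ (M ℕ.⊔ M′) (ℕ.≤-refl {m})
        u = a l - (seq c m + pow κ l * e m)
        v = pow κ l * (e m - s)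
        w = seq c m - seq c l
    in begin
      ∣ (a l - pow κ l * s) - seq c l ∣
        ≡⟨ cong ∣_∣ (solve 6 (λ a k s c d e → (a :- k :* s) :- d :=
             (a :- (c :+ k :* e)) :+ (k :* (e :- s) :+ (c :- d))) refl
             (a l) (pow κ l) s (seq c m) (seq c l) (e m)) ⟩
      ∣ u + (v + w) ∣          ≤⟨ ℚ.∣p+q∣≤∣p∣+∣q∣ u (v + w) ⟩
      ∣ u ∣ + ∣ v + w ∣        ≤⟨ ℚ.+-monoʳ-≤ (∣ u ∣) (ℚ.∣p+q∣≤∣p∣+∣q∣ v w) ⟩
      ∣ u ∣ + (∣ v ∣ + ∣ w ∣)  ≤⟨ ℚ.+-mono-≤ (near′ m (ℕ.m⊔n≤o⇒m≤o N′ (M ℕ.⊔ M′) ℕ.≤-refl))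
                                   (ℚ.+-mono-≤ (close′ m (ℕ.m⊔n≤o⇒n≤o M M′ M⊔M′≤m))
                                               (close m l (ℕ.m⊔n≤o⇒m≤o M M′ M⊔M′≤m) M≤l)) ⟩
      h + (½ * h + ½ * h)      ≡⟨ cong (h +_) (½ε+½ε≡ε h) ⟩
      h + h                    ≡⟨ ½ε+½ε≡ε ε ⟩
      ε                        ∎
    where open ℚ.≤-Reasoning

  -- The recurrence for what remains after subtracting the polynomial is part of the conclusion,
  -- because the coefficient one degree lower is the limit of that remainder rescaled.
  recurrent⇒rational : ∀ p {a} → Recurrent a → Converges a p →
    ∃[ r ] Recurrent (λ l → a l - evalℚ (coefficients {p} r) (pow κ l))
  recurrent⇒rational []      {a} rec a→ = [] , Recurrent-cong (λ l → ℚ.+-identityʳ (a l)) rec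
  recurrent⇒rational (c ∷ p) {a} rec a→ =
    let r , rec′ = recurrent⇒rational p (Recurrent-scale κ ω (trans (ℚ.*-comm κ ω) ω*κ≡1) rec)
                     (divide-step a c p (a→ 1ℚ (ℚ.positive⁻¹ 1ℚ)))
        s = λ l → evalℚ (coefficients r) (pow κ l)
        d = λ l → a l - pow κ l * s l
        -- Multiplying the remainder ω^l a(l) - p(κ^l) of the recursive call by κ^l gives `d`.
        rec-d : Recurrent d
        rec-d = Recurrent-cong (λ l → trans
            (cong (_- pow κ l * s l) (trans (sym (ℚ.*-identityˡ (a l))) (cong (_* a l) (sym (ω^l*κ^l≡1 l)))))
            (trans (solve 4 (λ w k a s → w :* k :* a :- k :* s := k :* (w :* a :- s)) refl (pow ω l) (pow κ l) (a l) (s l))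
              refl))
          (Recurrent-scale ω κ ω*κ≡1 rec′)
        χ , χ≢0 , χd = rec-d
        q , c≈q = limit-rational (length χ) χ refl χ≢0 d c 0ℚ χd (constant-limit a c r a→)
    in (q , c≈q) ∷ r , Recurrent-cong
         (λ l → solve 3 (λ a q t → a :- (q :+ t) := (a :- t) :- q) refl (a l) q (pow κ l * s l))
         (Recurrent-translate q rec-d)

-- From regularity to a recurrence

-- Gaussian elimination. Unless the first vector is zero, it has a pivot; multiples of it clear the
-- pivot column of the later vectors, which are dependent by induction in one dimension less.
dependent : ∀ m (v : ℕ → Fin m → ℚ) →
            ∃[ χ ] ¬ Zero χ × (∀ j → act χ (λ i → v i j) 0 ≡ 0ℚ)
dependent m v with Fin.all? (λ j → v 0 j ℚ.≟ 0ℚ)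
... | yes v₀≡0 = 1ℚ ∷ [] , (λ { (() ∷ _) }) , λ j →
  trans (ℚ.+-identityʳ (1ℚ * v 0 j)) (trans (ℚ.*-identityˡ (v 0 j)) (v₀≡0 j))
dependent zero    v | no v₀≢0 = contradiction (λ ()) v₀≢0
dependent (suc m) v | no v₀≢0 =
  let χ , χ≢0 , χw = dependent m (λ i → w i ∘ punchIn j)
      s = act χ (λ i → v (suc i) j) 0
  -- Expanding the relation among the `w i` gives the later vectors the coefficients p χ, and `v 0`
  -- the coefficient - s.
  in - s ∷ map (p *_) χ
   , (λ { (_ ∷ zs) → χ≢0 (map-*-Zero p (1/ p) (ℚ.*-inverseˡ p) χ zs) })
   , λ j′ → let t = act χ (λ i → v (suc i) j′) 0 in begin
     - s * v 0 j′ + act (map (p *_) χ) (λ i → v i j′) 1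
       ≡⟨ cong (- s * v 0 j′ +_) (trans (act-map-* p χ _ 1) (cong (p *_) (act-suc χ _ 0))) ⟩
     - s * v 0 j′ + p * t
       ≡⟨ solve 4 (λ s u p t → (:- s) :* u :+ p :* t := p :* t :+ (:- u) :* s) refl s (v 0 j′) p t ⟩
     p * t + - v 0 j′ * s
       ≡⟨ cong₂ _+_ (act-* χ p _ 0) (act-* χ (- v 0 j′) _ 0) ⟨
     act χ (λ i → p * v (suc i) j′) 0 + act χ (λ i → - v 0 j′ * v (suc i) j) 0
       ≡⟨ act-+ χ _ _ 0 ⟨
     act χ (λ i → w i j′) 0
       ≡⟨ χw≡0 χ χw j′ ⟩
     0ℚ ∎
  where
  open ≡-Reasoning

  pivot = Fin.¬∀⟶∃¬ (suc m) (λ j → v 0 j ≡ 0ℚ) (λ j → v 0 j ℚ.≟ 0ℚ) v₀≢0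
  j = proj₁ pivot
  p = v 0 j
  instance p≢0 = ℚ.≢-nonZero (proj₂ pivot)

  w : ℕ → Fin (suc m) → ℚ
  w i j′ = p * v (suc i) j′ + - v 0 j′ * v (suc i) j

  w-pivot : ∀ i → w i j ≡ 0ℚ
  w-pivot i = solve 2 (λ p x → p :* x :+ (:- p) :* x := con 0ℚ) refl p (v (suc i) j)

  χw≡0 : ∀ χ → (∀ c → act χ (λ i → w i (punchIn j c)) 0 ≡ 0ℚ) → ∀ j′ → act χ (λ i → w i j′) 0 ≡ 0ℚ
  χw≡0 χ χw j′ with j Fin.≟ j′
  ... | yes refl = trans (act-cong χ w-pivot 0) (act-zero χ 0)
  ... | no  j≢j′ = subst (λ c → act χ (λ i → w i c) 0 ≡ 0ℚ) (Fin.punchIn-punchOut j≢j′) (χw (punchOut j≢j′))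

-- The coefficients are rational, although spans are over ℤ, because the elimination is done over ℚ.
combination : (gs : List (ℕ → ℤ)) → (Fin (length gs) → ℚ) → ℕ → ℚ
combination []       z n = 0ℚ
combination (g ∷ gs) z n = z zero * ι (g n) + combination gs (z ∘ suc) n

combination-0 : ∀ gs n → combination gs (λ _ → 0ℚ) n ≡ 0ℚ
combination-0 []       n = refl
combination-0 (g ∷ gs) n = cong₂ _+_ (ℚ.*-zeroˡ (ι (g n))) (combination-0 gs n)

combination-+ : ∀ gs y z n →
  combination gs (λ j → y j + z j) n ≡ combination gs y n + combination gs z n
combination-+ []       y z n = refl
combination-+ (g ∷ gs) y z n = trans
  (cong ((y zero + z zero) * ι (g n) +_) (combination-+ gs (y ∘ suc) (z ∘ suc) n))
  (solve 5 (λ y z g u v → (y :+ z) :* g :+ (u :+ v) := (y :* g :+ u) :+ (z :* g :+ v)) refl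
    (y zero) (z zero) (ι (g n)) (combination gs (y ∘ suc) n) (combination gs (z ∘ suc) n))

combination-neg : ∀ gs z n → combination gs (λ j → - z j) n ≡ - combination gs z n
combination-neg []       z n = refl
combination-neg (g ∷ gs) z n = trans
  (cong (- z zero * ι (g n) +_) (combination-neg gs (z ∘ suc) n))
  (solve 3 (λ z g u → (:- z) :* g :+ (:- u) := :- (z :* g :+ u)) refl
    (z zero) (ι (g n)) (combination gs (z ∘ suc) n))

act-combination : ∀ χ gs (v : ℕ → Fin (length gs) → ℚ) n i →
  act χ (λ i → combination gs (v i) n) i ≡ combination gs (λ j → act χ (λ i → v i j) i) n
act-combination χ []       v n i = act-zero χ i
act-combination χ (g ∷ gs) v n i = trans (act-+ χ _ _ i) (cong₂ _+_
  (trans (act-cong χ (λ i → ℚ.*-comm (v i zero) (ι (g n))) i)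
    (trans (act-* χ (ι (g n)) (λ i → v i zero) i) (ℚ.*-comm (ι (g n)) (act χ (λ i → v i zero) i))))
  (act-combination χ gs (λ i → v i ∘ suc) n i))

combination-cong : ∀ gs {y z} → y ≗ z → combination gs y ≗ combination gs z
combination-cong []       y≗z n = refl
combination-cong (g ∷ gs) y≗z n =
  cong₂ _+_ (cong (_* ι (g n)) (y≗z zero)) (combination-cong gs (y≗z ∘ suc) n)

∈⇒combination : ∀ {gs x} → x ∈ gs → ∃[ z ] ∀ n → ι (x n) ≡ combination gs z n
∈⇒combination {g ∷ gs} (here x≈g) = (λ { zero → 1ℚ ; (suc _) → 0ℚ }) , λ n →
  trans (cong ι (x≈g n)) (trans (sym (ℚ.*-identityˡ (ι (g n)))) (trans (sym (ℚ.+-identityʳ (1ℚ * ι (g n))))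
    (cong (1ℚ * ι (g n) +_) (sym (combination-0 gs n)))))
∈⇒combination {g ∷ gs} (there x∈gs) = let z , x≡z = ∈⇒combination x∈gs in
  (λ { zero → 0ℚ ; (suc j) → z j }) , λ n → trans (x≡z n)
    (trans (sym (ℚ.+-identityˡ (combination gs z n)))
      (cong (_+ combination gs z n) (sym (ℚ.*-zeroˡ (ι (g n))))))

span⇒combination : ∀ {gs x} → Span sequences (_∈ gs) x → ∃[ z ] ∀ n → ι (x n) ≡ combination gs z n
span⇒combination      (gen x∈gs)  = ∈⇒combination x∈gs
span⇒combination {gs} unit        = (λ _ → 0ℚ) , λ n → sym (combination-0 gs n)
span⇒combination {gs} (mul {x} {y} x∈ y∈) =
  let u , x≡u = span⇒combination x∈
      v , y≡v = span⇒combination y∈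
  in (λ j → u j + v j) , λ n → trans (ι-+ (x n) (y n))
       (trans (cong₂ _+_ (x≡u n) (y≡v n)) (sym (combination-+ gs u v n)))
span⇒combination {gs} (inv {x} x∈) = let u , x≡u = span⇒combination x∈ in
  (λ j → - u j) , λ n → trans (ι-neg (x n)) (trans (cong -_ (x≡u n)) (sym (combination-neg gs u n)))
span⇒combination      (resp x≈y x∈) = let u , x≡u = span⇒combination x∈ in
  u , λ n → trans (cong ι (sym (x≈y n))) (x≡u n)

-- The dependence among the sequences f(k^l n), evaluated at n = k^s, is the recurrence at index s,
-- because k^l k^s = k^(l + s).
regular⇒recurrent : ∀ k → 2 ℕ.≤ k → ∀ f → k -Regular f → Recurrent (λ l → ι (f (k ℕ.^ l)))
regular⇒recurrent k 2≤k f (gs , kernel⊆gs , _) =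
  let χ , χ≢0 , χv = dependent (length gs) (proj₁ ∘ coords)
  in χ , χ≢0 , λ s → begin
    act χ (λ l → ι (f (k ℕ.^ l))) s
      ≡⟨ act-at χ (λ l → ι (f (k ℕ.^ l))) s ⟩
    act χ (λ l → ι (f (k ℕ.^ (l ℕ.+ s)))) 0
      ≡⟨ act-cong χ (λ l → trans (cong (ι ∘ f) (trans (ℕ.^-distribˡ-+-* k l s) (sym (ℕ.+-identityʳ _)))) 
           (proj₂ (coords l) (k ℕ.^ s))) 0 ⟩
    act χ (λ l → combination gs (proj₁ (coords l)) (k ℕ.^ s)) 0
      ≡⟨ act-combination χ gs (proj₁ ∘ coords) (k ℕ.^ s) 0 ⟩
    combination gs (λ j → act χ (λ i → proj₁ (coords i) j) 0) (k ℕ.^ s)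
      ≡⟨ trans (combination-cong gs χv (k ℕ.^ s)) (combination-0 gs (k ℕ.^ s)) ⟩
    0ℚ ∎
  where
  open ≡-Reasoning
  instance k≢0 = ℕ.>-nonZero (ℕ.≤-trans (ℕ.s≤s ℕ.z≤n) 2≤k)

  coords : ∀ l → ∃[ z ] ∀ n → ι (f (k ℕ.^ l ℕ.* n ℕ.+ 0)) ≡ combination gs z n
  coords l = span⇒combination (kernel⊆gs (gen (l , 0 , ℕ.m^n>0 k l , λ _ → refl)))

  act-at : ∀ χ a s → act χ a s ≡ act χ (λ i → a (i ℕ.+ s)) 0
  act-at []      a s = refl
  act-at (c ∷ χ) a s = cong (c * a s +_) (trans (act-at χ a (suc s))
    (trans (act-cong χ (λ i → cong a (ℕ.+-suc i s)) 0) (sym (act-suc χ (λ i → a (i ℕ.+ s)) 0))))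

-- From the recurrence to rational coefficients

reciprocal-small : ∀ w t ε → 0ℚ < w → w * t ≡ 1ℚ → 0ℚ < ε → ι (ℚ.↧ ε) ≤ t → w ≤ ε
reciprocal-small w t ε 0<w wt≡1 0<ε d≤t = begin
  w                    ≡⟨ ℚ.*-identityʳ w ⟨
  -- The numerator of ε is at least 1, so ε times its denominator is at least 1.
  w * 1ℚ               ≤⟨ w*-mono (ι-mono-≤ (1≤↥ε ε 0<ε)) ⟩
  w * ι (ℚ.↥ ε)        ≡⟨ cong (w *_) (q*↧q≡↥q ε) ⟨
  w * (ε * ι (ℚ.↧ ε))  ≤⟨ w*-mono (ℚ.*-monoˡ-≤-nonNeg ε {{ℚ.nonNegative (ℚ.<⇒≤ 0<ε)}} d≤t) ⟩
  w * (ε * t)          ≡⟨ solve 3 (λ w e t → w :* (e :* t) := e :* (w :* t)) refl w ε t ⟩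
  ε * (w * t)          ≡⟨ cong (ε *_) wt≡1 ⟩
  ε * 1ℚ               ≡⟨ ℚ.*-identityʳ ε ⟩
  ε                    ∎
  where
  open ℚ.≤-Reasoning
  w*-mono : ∀ {p q} → p ≤ q → w * p ≤ w * q
  w*-mono = ℚ.*-monoˡ-≤-nonNeg w {{ℚ.nonNegative (ℚ.<⇒≤ 0<w)}}

pow-pos : ∀ w → 0ℚ < w → ∀ l → 0ℚ < pow w l
pow-pos w 0<w zero    = ℚ.positive⁻¹ 1ℚ
pow-pos w 0<w (suc l) = ℚ.positive⁻¹ (w * pow w l)
  {{ℚ.pos*pos⇒pos w {{ℚ.positive 0<w}} (pow w l) {{ℚ.positive (pow-pos w 0<w l)}}}}

ι-^ : ∀ k l → ι (ℤ.+ (k ℕ.^ l)) ≡ pow (ι (ℤ.+ k)) l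
ι-^ k zero    = refl
ι-^ k (suc l) = trans (cong ι (ℤ.pos-* k (k ℕ.^ l)))
  (trans (ι-* (ℤ.+ k) (ℤ.+ (k ℕ.^ l))) (cong (ι (ℤ.+ k) *_) (ι-^ k l)))

l<k^l : ∀ {k} → 2 ℕ.≤ k → ∀ l → l ℕ.< k ℕ.^ l
l<k^l     2≤k zero    = ℕ.s≤s ℕ.z≤n
l<k^l {k} 2≤k (suc l) = ℕ.≤-trans (ℕ.+-mono-≤ (ℕ.≤-trans (ℕ.s≤s ℕ.z≤n) (l<k^l 2≤k l)) (l<k^l 2≤k l))
  (ℕ.≤-trans (ℕ.≤-reflexive (cong (k ℕ.^ l ℕ.+_) (sym (ℕ.+-identityʳ (k ℕ.^ l)))))
    (ℕ.*-monoˡ-≤ (k ℕ.^ l) 2≤k))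

Null-pow : ∀ k w → 2 ℕ.≤ k → 0ℚ < w → w * ι (ℤ.+ k) ≡ 1ℚ → Null (pow w)
-- The denominator of ε is a sufficient threshold, since k^l exceeds l.
Null-pow k w 2≤k 0<w wk≡1 ε 0<ε = ℚ.↧ₙ ε , λ l d≤l →
  subst (_≤ ε) (sym (ℚ.0≤p⇒∣p∣≡p (ℚ.<⇒≤ (pow-pos w 0<w l))))
    (reciprocal-small (pow w l) (pow (ι (ℤ.+ k)) l) ε (pow-pos w 0<w l)
      (pow-inverse w (ι (ℤ.+ k)) wk≡1 l) 0<ε
      (subst (ι (ℚ.↧ ε) ≤_) (ι-^ k l) (ι-mono-≤ (ℤ.+≤+ (ℕ.≤-trans d≤l (ℕ.<⇒≤ (l<k^l 2≤k l)))))))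

floor-near : ∀ z x → z IsFloorOf x → Near (ι z) (seq x) 1ℚ
floor-near z x (z≤x , ε , 0<ε , N , x<z+1) =
  -- The inequality z ≤ x holds for representatives only up to a positive slack; the slack 1 is
  -- within the bound to be proved.
  let M , z≤x+1 = z≤x 1ℚ (ℚ.positive⁻¹ 1ℚ)
  in M ℕ.⊔ N , λ m ≤m →
     bound (ι z) (seq x m) (z≤x+1 m (ℕ.m⊔n≤o⇒m≤o M N ≤m))
       (subst (seq x m + ε ≤_) (ι-+ ℤ.1ℤ z) (x<z+1 m (ℕ.m⊔n≤o⇒n≤o M N ≤m)))
  where
  open ℚ.≤-Reasoning
  bound : ∀ z t → z ≤ t + 1ℚ → t + ε ≤ 1ℚ + z → ∣ z - t ∣ ≤ 1ℚ
  bound z t z≤t+1 t+ε≤1+z = ∣p∣≤q (z - t)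
    (begin
      z - t           ≤⟨ ℚ.+-monoˡ-≤ (- t) z≤t+1 ⟩
      (t + 1ℚ) - t    ≡⟨ solve 1 (λ t → (t :+ con 1ℚ) :- t := con 1ℚ) refl t ⟩
      1ℚ              ∎)
    (begin
      - (z - t)       ≡⟨ solve 2 (λ z t → :- (z :- t) := (t :+ con 0ℚ) :- z) refl z t ⟩
      (t + 0ℚ) - z    ≤⟨ ℚ.+-monoˡ-≤ (- z) (ℚ.≤-trans (ℚ.+-monoʳ-≤ t (ℚ.<⇒≤ 0<ε)) t+ε≤1+z) ⟩
      (1ℚ + z) - z    ≡⟨ solve 1 (λ z → (con 1ℚ :+ z) :- z := con 1ℚ) refl z ⟩
      1ℚ              ∎)


ι-pos : ∀ z → ℤ.1ℤ ℤ.≤ z → 0ℚ < ι z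
ι-pos z 1≤z = ℚ.<-≤-trans (ℚ.positive⁻¹ 1ℚ) (ι-mono-≤ 1≤z)

-- The error of the floor stays bounded without vanishing, so one division by κ^l comes first. It
-- costs the constant term, about which nothing is claimed.
powers⇒rational : ∀ c p a κ ω → ω * κ ≡ 1ℚ → Null (pow ω) → Recurrent a →
  (∀ l → Near (a l) (evalSeq (c ∷ p) (pow κ l)) 1ℚ) → All IsRational p
powers⇒rational c p a κ ω ωκ≡1 ω→0 rec near = proj₁ (recurrent⇒rational p
    (Recurrent-scale κ ω (trans (ℚ.*-comm κ ω) ωκ≡1) rec)
    (divide-step a c p (0 , λ l _ → near l)))
  where open Powers κ ω ωκ≡1 ω→0

regular⇒rational : ∀ p f → (∀ n → f n IsFloorOf eval p (fromℕ n)) →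
                   Regular f → All IsRational (drop 1 p)
regular⇒rational []      f floors _ = []
regular⇒rational (c ∷ p) f floors (k , 2≤k , regular) =
  let ω , 0<ω , κω≡1 = quotient>0 (ι (ℤ.+ k)) 1ℚ 0<κ (ℚ.positive⁻¹ 1ℚ)
      ωκ≡1 = trans (ℚ.*-comm ω (ι (ℤ.+ k))) κω≡1
  in powers⇒rational c p (λ l → ι (f (k ℕ.^ l))) (ι (ℤ.+ k)) ω ωκ≡1
       (Null-pow k ω 2≤k 0<ω ωκ≡1) (regular⇒recurrent k 2≤k f regular) near
  where
  0<κ : 0ℚ < ι (ℤ.+ k)
  0<κ = ι-pos (ℤ.+ k) (ℤ.+≤+ (ℕ.≤-trans (ℕ.s≤s ℕ.z≤n) 2≤k))

  near : ∀ l → Near (ι (f (k ℕ.^ l))) (evalSeq (c ∷ p) (pow (ι (ℤ.+ k)) l)) 1ℚ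
  near l = let M , close = floor-near (f (k ℕ.^ l)) (eval (c ∷ p) (fromℕ (k ℕ.^ l))) (floors (k ℕ.^ l)) in
    M , λ m M≤m → subst (λ v → ∣ ι (f (k ℕ.^ l)) - v ∣ ≤ 1ℚ)
      (trans (seq-eval (c ∷ p) (k ℕ.^ l) m) (cong (λ t → evalSeq (c ∷ p) t m) (ι-^ k l)))
      (close m M≤m)

-- Products of operators E^t − a

Δ : ℕ → ℤ → (ℕ → ℚ) → ℕ → ℚ
Δ t a u n = u (n ℕ.+ t) - ι a * u n

Δs : ℕ → List ℤ → (ℕ → ℚ) → ℕ → ℚ
Δs t []       u = u
Δs t (a ∷ as) u = Δs t as (Δ t a u)

Kills : ℕ → List ℤ → (ℕ → ℚ) → Set
Kills t as u = ∀ n → Δs t as u n ≡ 0ℚ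

Δs-cong : ∀ t as {u v} → u ≗ v → Δs t as u ≗ Δs t as v
Δs-cong t []       u≗v = u≗v
Δs-cong t (a ∷ as) u≗v = Δs-cong t as λ n →
  cong₂ _-_ (u≗v (n ℕ.+ t)) (cong (ι a *_) (u≗v n))

Δs-+ : ∀ t as u v n → Δs t as (λ i → u i + v i) n ≡ Δs t as u n + Δs t as v n
Δs-+ t []       u v n = refl
Δs-+ t (a ∷ as) u v n = trans
  (Δs-cong t as (λ i → solve 5 (λ a x y x′ y′ → (x′ :+ y′) :- a :* (x :+ y) :=
     (x′ :- a :* x) :+ (y′ :- a :* y)) refl (ι a) (u i) (v i) (u (i ℕ.+ t)) (v (i ℕ.+ t))) n)
  (Δs-+ t as (Δ t a u) (Δ t a v) n)

Δs-* : ∀ t as q u n → Δs t as (λ i → q * u i) n ≡ q * Δs t as u n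
Δs-* t []       q u n = refl
Δs-* t (a ∷ as) q u n = trans
  (Δs-cong t as (λ i → solve 4 (λ a q x x′ → q :* x′ :- a :* (q :* x) :=
     q :* (x′ :- a :* x)) refl (ι a) q (u i) (u (i ℕ.+ t))) n)
  (Δs-* t as q (Δ t a u) n)

Δs-translate : ∀ t as u M n → Δs t as (λ i → u (i ℕ.+ M)) n ≡ Δs t as u (n ℕ.+ M)
Δs-translate t []       u M n = refl
Δs-translate t (a ∷ as) u M n = trans
  (Δs-cong t as (λ i → cong (λ j → u j - ι a * u (i ℕ.+ M))
    (trans (ℕ.+-assoc i t M) (trans (cong (i ℕ.+_) (ℕ.+-comm t M)) (sym (ℕ.+-assoc i M t))))) n)
  (Δs-translate t as (Δ t a u) M n)

Kills-cong : ∀ t as {u v} → u ≗ v → Kills t as v → Kills t as u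
Kills-cong t as u≗v v↦0 n = trans (Δs-cong t as u≗v n) (v↦0 n)

Kills-0 : ∀ t as → Kills t as (λ _ → 0ℚ)
Kills-0 t as n = trans (Δs-* t as 0ℚ (λ _ → 0ℚ) n) (ℚ.*-zeroˡ (Δs t as (λ _ → 0ℚ) n))

Kills-+ : ∀ t as u v → Kills t as u → Kills t as v → Kills t as (λ i → u i + v i)
Kills-+ t as u v u↦0 v↦0 n = trans (Δs-+ t as u v n) (cong₂ _+_ (u↦0 n) (v↦0 n))

Kills-* : ∀ t as q u → Kills t as u → Kills t as (λ i → q * u i)
Kills-* t as q u u↦0 n = trans (Δs-* t as q u n) (trans (cong (q *_) (u↦0 n)) (ℚ.*-zeroʳ q))

Kills-translate : ∀ t as u M → Kills t as u → Kills t as (λ i → u (i ℕ.+ M))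
Kills-translate t as u M u↦0 n = trans (Δs-translate t as u M n) (u↦0 (n ℕ.+ M))

-- A factor applied first does no harm: E^t - a combines a translate and a multiple, and both
-- preserve being killed.
Kills-∷ : ∀ t a as u → Kills t as u → Kills t (a ∷ as) u
Kills-∷ t a as u u↦0 = Kills-cong t as
  (λ n → cong (u (n ℕ.+ t) +_) (ℚ.neg-distribˡ-* (ι a) (u n)))
  (Kills-+ t as (λ n → u (n ℕ.+ t)) (λ n → - ι a * u n)
    (Kills-translate t as u t u↦0) (Kills-* t as (- ι a) u u↦0))

Kills-++ : ∀ t as bs u → Kills t as u → Kills t (as ++ bs) u
Kills-++ t []       bs u u↦0 = Kills-cong t bs u↦0 (Kills-0 t bs)
Kills-++ t (a ∷ as) bs u u↦0 = Kills-++ t as bs (Δ t a u) u↦0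

-- E^t - 1 kills the t-periodic sequence u - v, so it maps `u` and `v` to the same sequence.
Kills-difference : ∀ t as u v → (∀ n → u (n ℕ.+ t) - v (n ℕ.+ t) ≡ u n - v n) →
                   Kills t (ℤ.1ℤ ∷ as) v → Kills t (ℤ.1ℤ ∷ as) u
Kills-difference t as u v periodic = Kills-cong t as λ n → begin
  u (n ℕ.+ t) - 1ℚ * u n
    ≡⟨ solve 3 (λ x′ x y′ → x′ :- con 1ℚ :* x := (x′ :- y′) :+ (y′ :- x)) refl (u (n ℕ.+ t)) (u n) (v (n ℕ.+ t)) ⟩
  (u (n ℕ.+ t) - v (n ℕ.+ t)) + (v (n ℕ.+ t) - u n)
    ≡⟨ cong (_+ (v (n ℕ.+ t) - u n)) (periodic n) ⟩
  (u n - v n) + (v (n ℕ.+ t) - u n)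
    ≡⟨ solve 3 (λ x y y′ → (x :- y) :+ (y′ :- x) := y′ :- con 1ℚ :* y) refl (u n) (v n) (v (n ℕ.+ t)) ⟩
  v (n ℕ.+ t) - 1ℚ * v n ∎
  where open ≡-Reasoning

Kills-const : ∀ t as q → Kills t (ℤ.1ℤ ∷ as) (λ _ → q)
Kills-const t as q = Kills-cong t as
  (λ _ → solve 1 (λ q → q :- con 1ℚ :* q := con 0ℚ) refl q) (Kills-0 t as)

ones : ℕ → List ℤ
ones m = replicate m ℤ.1ℤ

module _ {t : ℕ} {N : ℕ → ℚ} {d : ℚ} (step : ∀ n → N (n ℕ.+ t) ≡ N n + d) where

  -- A product rule: (E^t - 1)(N u) = N (E^t - 1) u + d E^t u. Multiplying by the progression `N`
  -- therefore costs one more factor.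
  Kills-ones-* : ∀ m u → Kills t (ones m) u → Kills t (ones (suc m)) (λ n → N n * u n)
  Kills-ones-* zero    u u↦0 = Kills-cong t (ones 1)
    (λ n → trans (cong (N n *_) (u↦0 n)) (ℚ.*-zeroʳ (N n))) (Kills-0 t (ones 1))
  Kills-ones-* (suc m) u u↦0 = Kills-cong t (ones (suc m))
    (λ n → trans (cong (λ x → x * u (n ℕ.+ t) - 1ℚ * (N n * u n)) (step n))
      (solve 4 (λ x d y y′ → (x :+ d) :* y′ :- con 1ℚ :* (x :* y) :=
         x :* (y′ :- con 1ℚ :* y) :+ d :* y′) refl (N n) d (u n) (u (n ℕ.+ t))))
    (Kills-+ t (ones (suc m)) (λ n → N n * Δ t ℤ.1ℤ u n) (λ n → d * u (n ℕ.+ t))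
      (Kills-ones-* m (Δ t ℤ.1ℤ u) u↦0)
      (Kills-* t (ones (suc m)) d (λ n → u (n ℕ.+ t)) (Kills-translate t (ones (suc m)) u t u↦0)))

  Kills-ones-evalℚ : ∀ qs → Kills t (ones (length qs)) (λ n → evalℚ qs (N n))
  Kills-ones-evalℚ []       = λ n → refl
  Kills-ones-evalℚ (q ∷ qs) = Kills-+ t (ones (suc (length qs))) (λ _ → q) (λ n → N n * evalℚ qs (N n))
    (Kills-const t (ones (length qs)) q)
    (Kills-ones-* (length qs) (λ n → evalℚ qs (N n)) (Kills-ones-evalℚ qs))

-- The roots 1, κ, ..., κ^(L - 1), built by scaling because multiplication by a geometric sequence
-- of ratio κ scales every root by κ.
powers : ℤ → ℕ → List ℤ
powers κ zero    = []
powers κ (suc L) = ℤ.1ℤ ∷ map (κ ℤ.*_) (powers κ L)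

length-powers : ∀ κ L → length (powers κ L) ≡ L
length-powers κ zero    = refl
length-powers κ (suc L) = cong suc (trans (List.length-map (κ ℤ.*_) (powers κ L)) (length-powers κ L))

powers-snoc : ∀ κ L → powers κ L ++ (κ ℤ.^ L ∷ []) ≡ powers κ (suc L)
powers-snoc κ zero    = refl
powers-snoc κ (suc L) = cong (ℤ.1ℤ ∷_) (trans
  (sym (List.map-++ (κ ℤ.*_) (powers κ L) (κ ℤ.^ L ∷ []))) (cong (map (κ ℤ.*_)) (powers-snoc κ L)))

module _ {κ : ℤ} {P : ℕ → ℚ} (step : ∀ n → P (n ℕ.+ 1) ≡ ι κ * P n) where

  -- (E - κ a)(P u) = κ P (E - a) u for a geometric sequence `P` of ratio κ.
  Kills-powers-* : ∀ as u → Kills 1 as u → Kills 1 (map (κ ℤ.*_) as) (λ n → P n * u n)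
  Kills-powers-* []       u u↦0 n = trans (cong (P n *_) (u↦0 n)) (ℚ.*-zeroʳ (P n))
  Kills-powers-* (a ∷ as) u u↦0 = Kills-cong 1 (map (κ ℤ.*_) as)
    (λ n → trans (cong₂ (λ x b → x * u (n ℕ.+ 1) - b * (P n * u n)) (step n) (ι-* κ a))
      (solve 5 (λ κ x a y y′ → κ :* x :* y′ :- κ :* a :* (x :* y) := κ :* (x :* (y′ :- a :* y))) refl
        (ι κ) (P n) (ι a) (u n) (u (n ℕ.+ 1))))
    (Kills-* 1 (map (κ ℤ.*_) as) (ι κ) (λ n → P n * Δ 1 a u n) (Kills-powers-* as (Δ 1 a u) u↦0))

  -- Horner's step q + (P + r) u is regrouped as (q + r u) + P u. The constant needs the root 1; r u
  -- has the roots 1, ..., κ^(L - 1), extended at the end by κ^L; P u has κ, ..., κ^L, extended in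
  -- front by 1.
  Kills-powers-evalℚ : ∀ r qs → Kills 1 (powers κ (length qs)) (λ n → evalℚ qs (P n + r))
  Kills-powers-evalℚ r []       = λ n → refl
  Kills-powers-evalℚ r (q ∷ qs) = Kills-cong 1 (powers κ (suc L))
    (λ n → solve 4 (λ q x r y → q :+ (x :+ r) :* y := (q :+ r :* y) :+ x :* y) refl q (P n) r (u n))
    (Kills-+ 1 (powers κ (suc L)) (λ n → q + r * u n) (λ n → P n * u n)
      (Kills-+ 1 (powers κ (suc L)) (λ _ → q) (λ n → r * u n)
        (Kills-const 1 (map (κ ℤ.*_) (powers κ L)) q)
        (Kills-* 1 (powers κ (suc L)) r u
          (subst (λ as → Kills 1 as u) (powers-snoc κ L) (Kills-++ 1 (powers κ L) (κ ℤ.^ L ∷ []) u u↦0))))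
      (Kills-∷ 1 ℤ.1ℤ (map (κ ℤ.*_) (powers κ L)) (λ n → P n * u n) (Kills-powers-* (powers κ L) u u↦0)))
    where
    L = length qs
    u = λ n → evalℚ qs (P n + r)
    u↦0 = Kills-powers-evalℚ r qs

-- Spans

Span-bind : ∀ {S T : Pred (ℕ → ℤ) 0ℓ} → (∀ {x} → S x → Span sequences T x) →
            ∀ {x} → Span sequences S x → Span sequences T x
Span-bind S⊆T (gen x∈)      = S⊆T x∈
Span-bind S⊆T unit          = unit
Span-bind S⊆T (mul x∈ y∈)   = mul (Span-bind S⊆T x∈) (Span-bind S⊆T y∈)
Span-bind S⊆T (inv x∈)      = inv (Span-bind S⊆T x∈)
Span-bind S⊆T (resp x≈y x∈) = resp x≈y (Span-bind S⊆T x∈)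

module _ {S : Pred (ℕ → ℤ) 0ℓ} where

  Span-*ℕ : ∀ a {x} → Span sequences S x → Span sequences S (λ n → ℤ.+ a ℤ.* x n)
  Span-*ℕ zero    {x} x∈ = resp (λ n → sym (ℤ.*-zeroˡ (x n))) unit
  Span-*ℕ (suc a) {x} x∈ = resp (λ n → sym (ℤ.suc-* (ℤ.+ a) (x n))) (mul x∈ (Span-*ℕ a x∈))

  Span-* : ∀ a {x} → Span sequences S x → Span sequences S (λ n → a ℤ.* x n)
  Span-* (ℤ.+ a)          x∈ = Span-*ℕ a x∈
  Span-* (ℤ.-[1+ a ]) {x} x∈ = resp (λ n → ℤ.neg-distribˡ-* (ℤ.+ suc a) (x n)) (inv (Span-*ℕ (suc a) x∈))

  -- As E^t - a is monic with `a` an integer, each member is a difference plus `a` times the member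
  -- t places earlier; no division occurs.
  Δ-Span : ∀ t → 0 ℕ.< t → ∀ a (G : ℕ → ℕ → ℤ) →
    (∀ i → i ℕ.< t → Span sequences S (G i)) →
    (∀ i → Span sequences S (λ n → G (i ℕ.+ t) n ℤ.- a ℤ.* G i n)) →
    ∀ i → Span sequences S (G i)
  Δ-Span t 0<t a G initial Δ∈ i = below (suc i) i ℕ.≤-refl
    where
    below : ∀ N i → i ℕ.< N → Span sequences S (G i)
    below (suc N) i i<1+N with i ℕ.<? t
    ... | yes i<t = initial i i<t
    ... | no  i≮t = subst (Span sequences S ∘ G) (ℕ.m∸n+n≡m t≤i) (resp
        (λ n → trans (ℤ.+-assoc (G (j ℕ.+ t) n) (ℤ.- (a ℤ.* G j n)) (a ℤ.* G j n))
                 (trans (cong (λ z → G (j ℕ.+ t) n ℤ.+ z) (ℤ.+-inverseˡ (a ℤ.* G j n))) (ℤ.+-identityʳ (G (j ℕ.+ t) n))))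
        (mul (Δ∈ j) (Span-* a (below N j (ℕ.<-≤-trans (ℕ.∸-monoʳ-< 0<t t≤i) (ℕ.≤-pred i<1+N))))))
      where
      t≤i = ℕ.≮⇒≥ i≮t
      j = i ℕ.∸ t

  -- One factor is peeled off at a time. The differences G (i + t) - a G i are killed by the other
  -- factors, and their initial members involve only initial members of `G`.
  Kills-Span : ∀ t → 0 ℕ.< t → ∀ as (G : ℕ → ℕ → ℤ) →
    (∀ n → Kills t as (λ i → ι (G i n))) →
    (∀ i → i ℕ.< length as ℕ.* t → Span sequences S (G i)) →
    ∀ i → Span sequences S (G i)
  Kills-Span t 0<t []       G killed initial i = resp (λ n → sym (ι-injective (killed n i))) unit
  Kills-Span t 0<t (a ∷ as) G killed initial = Δ-Span t 0<t a G
    (λ i i<t → initial i (ℕ.<-≤-trans i<t (ℕ.m≤m+n t (length as ℕ.* t))))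
    (Kills-Span t 0<t as (λ i n → G (i ℕ.+ t) n ℤ.- a ℤ.* G i n)
      (λ n → Kills-cong t as
        (λ i → trans (ι-- (G (i ℕ.+ t) n) (a ℤ.* G i n)) (cong (λ z → ι (G (i ℕ.+ t) n) - z) (ι-* a (G i n))))
        (killed n))
      (λ i i<m → mul (initial (i ℕ.+ t) (subst (i ℕ.+ t ℕ.<_) (ℕ.+-comm (length as ℕ.* t) t) (ℕ.+-monoˡ-< t i<m)))
                     (inv (Span-* a (initial i (ℕ.<-≤-trans i<m (ℕ.m≤n+m (length as ℕ.* t) t)))))))

  ∈⇒Span : ∀ {gs} → All S gs → ∀ {x} → x ∈ gs → Span sequences S x
  ∈⇒Span (s ∷ _)  (here x≈g)   = resp (sym ∘ x≈g) (gen s)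
  ∈⇒Span (_ ∷ ss) (there x∈gs) = ∈⇒Span ss x∈gs

-- Periodicity of f − q

Integral : ℚ → Set
Integral q = ∃[ z ] q ≡ ι z

Integral-+ : ∀ {p q} → Integral p → Integral q → Integral (p + q)
Integral-+ (y , p≡) (z , q≡) = y ℤ.+ z , trans (cong₂ _+_ p≡ q≡) (sym (ι-+ y z))

Integral-* : ∀ {p q} → Integral p → Integral q → Integral (p * q)
Integral-* (y , p≡) (z , q≡) = y ℤ.* z , trans (cong₂ _*_ p≡ q≡) (sym (ι-* y z))

module _ (d : ℚ) (d-int : Integral d) where

  evalℚ-Integral : ∀ {qs} → All (λ q → Integral (q * d)) qs →
    ∀ t → Integral t → Integral (evalℚ qs t * d)
  evalℚ-Integral []                   t t-int = ℤ.0ℤ , ℚ.*-zeroˡ d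
  evalℚ-Integral {q ∷ qs} (qd ∷ qsd) t t-int = subst Integral
    (solve 4 (λ q d t s → q :* d :+ t :* (s :* d) := (q :+ t :* s) :* d) refl q d t (evalℚ qs t))
    (Integral-+ qd (Integral-* t-int (evalℚ-Integral qsd t t-int)))

  -- In Horner form the difference is t (s′ - s) + s′ d, where s and s′ are the tail at t and t + d.
  -- Here `d` is both the step and a common denominator, so s′ d is integral.
  evalℚ-difference : ∀ {qs} → All (λ q → Integral (q * d)) qs →
    ∀ t → Integral t → Integral (evalℚ qs (t + d) - evalℚ qs t)
  evalℚ-difference []                  t t-int = ℤ.0ℤ , refl
  evalℚ-difference {q ∷ qs} (_ ∷ qsd) t t-int = subst Integral
    (solve 5 (λ q d t s s′ → t :* (s′ :- s) :+ s′ :* d := (q :+ (t :+ d) :* s′) :- (q :+ t :* s)) refl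
      q d t (evalℚ qs t) (evalℚ qs (t + d)))
    (Integral-+ (Integral-* t-int (evalℚ-difference qsd t t-int))
                (evalℚ-Integral qsd (t + d) (Integral-+ t-int d-int)))

common-denominator : ∀ qs → ∃[ D ] 0 ℕ.< D × All (λ q → Integral (q * ι (ℤ.+ D))) qs
common-denominator []       = 1 , ℕ.s≤s ℕ.z≤n , []
common-denominator (q ∷ qs) = let D , 0<D , qsD = common-denominator qs in
    D ℕ.* ℚ.↧ₙ q
  , ℕ.*-mono-< 0<D (ℕ.s≤s ℕ.z≤n)
  , step q (ℤ.+ D) (ℚ.↧ q) (ℤ.pos-* D (ℚ.↧ₙ q)) (ℚ.↥ q , q*↧q≡↥q q)
  ∷ All.map (λ {p} → step′ p (ℤ.+ D) (ℚ.↧ q) (ℤ.pos-* D (ℚ.↧ₙ q))) qsD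
  where
  step : ∀ p y z {w} → w ≡ y ℤ.* z → Integral (p * ι z) → Integral (p * ι w)
  step p y z refl int = subst Integral
    (trans (solve 3 (λ y p z → y :* (p :* z) := p :* (y :* z)) refl (ι y) p (ι z)) (cong (p *_) (sym (ι-* y z))))
    (Integral-* (y , refl) int)

  step′ : ∀ p y z {w} → w ≡ y ℤ.* z → Integral (p * ι y) → Integral (p * ι w)
  step′ p y z w≡yz = step p z y (trans w≡yz (ℤ.*-comm y z))

-- From z ≤ x + w < y + 1 + w, and z and y + w are integers.
floor-≤ : ∀ y z w x x′ → y IsFloorOf x → z IsFloorOf x′ →
          Null (λ m → seq x′ m - (seq x m + ι w)) → z ℤ.≤ y ℤ.+ w
floor-≤ y z w x x′ (_ , ε , 0<ε , M , x<1+y) (z≤x′ , _) close =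
  subst (z ℤ.≤_) (ℤ.pred-suc (y ℤ.+ w)) (ℤ.i<j⇒i≤pred[j] {z} {ℤ.suc (y ℤ.+ w)}
    (ι-cancel-< {z} {ℤ.suc (y ℤ.+ w)}
      (subst (ι z <_) (sym (trans (ι-+ ℤ.1ℤ (y ℤ.+ w)) (cong (1ℚ +_) (ι-+ y w)))) z<)))
  where
  open ℚ.≤-Reasoning
  -- The slack in z ≤ x′ and the distance from x′ to x + w cost η each, together h, which is less
  -- than the gap ε between x and y + 1.
  h = ½ * ε
  η = ½ * h
  0<h = ½ε>0 0<ε
  0<η = ½ε>0 0<h
  N = proj₁ (z≤x′ η 0<η)
  N′ = proj₁ (close η 0<η)
  m = M ℕ.⊔ (N ℕ.⊔ N′)
  N⊔N′≤m = ℕ.m≤n⊔m M (N ℕ.⊔ N′)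
  a = seq x m
  a′ = seq x′ m

  h<ε : h < ε
  h<ε = subst (h <_) (½ε+½ε≡ε ε) (subst (_< h + h) (ℚ.+-identityʳ h) (ℚ.+-monoʳ-< h 0<h))

  z< : ι z < 1ℚ + (ι y + ι w)
  z< = begin-strict
    ι z                               ≤⟨ proj₂ (z≤x′ η 0<η) m (ℕ.m⊔n≤o⇒m≤o N N′ N⊔N′≤m) ⟩
    a′ + η
      ≡⟨ solve 4 (λ a a′ w η → a′ :+ η := (a :+ w) :+ ((a′ :- (a :+ w)) :+ η)) refl a a′ (ι w) η ⟩
    (a + ι w) + ((a′ - (a + ι w)) + η)
      ≤⟨ ℚ.+-monoʳ-≤ (a + ι w) (ℚ.+-monoˡ-≤ η (ℚ.≤-trans (p≤∣p∣ (a′ - (a + ι w)))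
           (proj₂ (close η 0<η) m (ℕ.m⊔n≤o⇒n≤o N N′ N⊔N′≤m)))) ⟩
    (a + ι w) + (η + η)               ≡⟨ cong ((a + ι w) +_) (½ε+½ε≡ε h) ⟩
    (a + ι w) + h                     <⟨ ℚ.+-monoʳ-< (a + ι w) h<ε ⟩
    (a + ι w) + ε                     ≡⟨ solve 3 (λ a w ε → (a :+ w) :+ ε := (a :+ ε) :+ w) refl a (ι w) ε ⟩
    (a + ε) + ι w                     ≤⟨ ℚ.+-monoˡ-≤ (ι w) (x<1+y m (ℕ.m≤m⊔n M (N ℕ.⊔ N′))) ⟩
    ι (ℤ.suc y) + ι w                 ≡⟨ cong (_+ ι w) (ι-+ ℤ.1ℤ y) ⟩
    (1ℚ + ι y) + ι w                  ≡⟨ ℚ.+-assoc 1ℚ (ι y) (ι w) ⟩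
    1ℚ + (ι y + ι w)                  ∎

-- The reverse inequality is `floor-≤` for the translation by - w.
floor-translate : ∀ y z w x x′ → y IsFloorOf x → z IsFloorOf x′ →
                  Null (λ m → seq x′ m - (seq x m + ι w)) → z ≡ y ℤ.+ w
floor-translate y z w x x′ y≤x z≤x′ close = ℤ.≤-antisym (floor-≤ y z w x x′ y≤x z≤x′ close)
  (subst (y ℤ.+ w ℤ.≤_) (trans (ℤ.+-assoc z (ℤ.- w) w) (trans (cong (λ v → z ℤ.+ v) (ℤ.+-inverseˡ w))
      (ℤ.+-identityʳ z)))
    (ℤ.+-monoˡ-≤ w (floor-≤ z y (ℤ.- w) x′ x z≤x′ y≤x (Null-cong
      (λ m → trans (cong (λ v → seq x m - (seq x′ m + v)) (ι-neg w))
        (solve 3 (λ a a′ w → a :- (a′ :+ (:- w)) := (:- con 1ℚ) :* (a′ :- (a :+ w))) refl (seq x m) (seq x′ m) (ι w)))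
      (Null-* (- 1ℚ) close)))))

-- p and the rational polynomial qs, which has the same coefficients except
-- for the constant term, change by the same amount between m and n.
floor-minus-poly : ∀ {c p} (r : All IsRational p) {f : ℕ → ℤ} →
  (∀ n → f n IsFloorOf eval (c ∷ p) (fromℕ n)) → ∀ m n →
  let q = λ n → evalℚ (0ℚ ∷ coefficients r) (ι (ℤ.+ n)) in
  Integral (q n - q m) → ι (f n) - q n ≡ ι (f m) - q m
floor-minus-poly {c} {p} r {f} floors m n (w , qn-qm≡w) = begin
  ι (f n) - q n                     ≡⟨ cong (λ z → ι z - q n) fn≡ ⟩
  ι (f m ℤ.+ w) - q n               ≡⟨ cong (_- q n) (trans (ι-+ (f m) w) (cong (ι (f m) +_) (sym qn-qm≡w))) ⟩
  (ι (f m) + (q n - q m)) - q n     ≡⟨ solve 3 (λ f x y → (f :+ (x :- y)) :- x := f :- y) refl (ι (f m)) (q n) (q m) ⟩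
  ι (f m) - q m                     ∎
  where
  open ≡-Reasoning
  qs = coefficients r
  q : ℕ → ℚ
  q n = evalℚ (0ℚ ∷ qs) (ι (ℤ.+ n))

  -- The constant term `c` cancels, so its irrationality does not matter.
  close : ∀ s t {v} → evalℚ (0ℚ ∷ qs) t - evalℚ (0ℚ ∷ qs) s ≡ v →
          Null (λ i → evalSeq (c ∷ p) t i - (evalSeq (c ∷ p) s i + v))
  close s t refl = Null-cong
    (λ i → solve 7 (λ c s t es et qs qt →
       (c :+ t :* et) :- ((c :+ s :* es) :+ ((con 0ℚ :+ t :* qt) :- (con 0ℚ :+ s :* qs))) :=
       t :* (et :- qt) :+ (:- s) :* (es :- qs)) refl
       (seq c i) s t (evalSeq p s i) (evalSeq p t i) (evalℚ qs s) (evalℚ qs t))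
    (Null-+ (Null-* t (evalSeq-≈ r t)) (Null-* (- s) (evalSeq-≈ r s)))

  fn≡ : f n ≡ f m ℤ.+ w
  fn≡ = floor-translate (f m) (f n) w (eval (c ∷ p) (fromℕ m)) (eval (c ∷ p) (fromℕ n)) (floors m) (floors n)
    (Null-cong (λ i → cong₂ (λ y x → y - (x + ι w)) (seq-eval (c ∷ p) n i) (seq-eval (c ∷ p) m i))
      (close (ι (ℤ.+ m)) (ι (ℤ.+ n)) qn-qm≡w))

-- Finitely many generators of the kernel

periodic⇒regular : ∀ D E f q qs → let Q = λ n → evalℚ (q ∷ qs) (ι (ℤ.+ n)) in
  2 ℕ.≤ E ℕ.* D → 0 ℕ.< D → suc (length qs) ℕ.≤ E →
  (∀ n i → ι (f (i ℕ.* D ℕ.+ n)) - Q (i ℕ.* D ℕ.+ n) ≡ ι (f n) - Q n) → Regular f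
periodic⇒regular D E f q qs 2≤k 0<D L≤E periodic = k , 2≤k , gs
  , (λ {x} → Span-bind (λ { (l , r , r< , b≗) → resp (sym ∘ b≗) (kernel∈ l r r<) }))
  , (λ {x} → Span-bind (∈⇒Span gs-kernel))
  where
  k = E ℕ.* D
  L = suc (length qs)
  Q : ℕ → ℚ
  Q n = evalℚ (q ∷ qs) (ι (ℤ.+ n))
  instance k≢0 = ℕ.>-nonZero (ℕ.≤-trans (ℕ.s≤s ℕ.z≤n) 2≤k)

  -- The exponent starts at 1 so that `D` divides the power of k; exponent 0 contributes only f
  -- itself.
  G : ℕ → ℕ → ℕ → ℤ
  G l r n = f (k ℕ.^ suc l ℕ.* n ℕ.+ r)

  gs = f ∷ cartesianProductWith G (upTo L) (upTo (L ℕ.* D))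

  k≤k^1+l : ∀ l → k ℕ.≤ k ℕ.^ suc l
  k≤k^1+l l = ℕ.m≤m*n k (k ℕ.^ l) {{ℕ.m^n≢0 k l}}

  gs-kernel : All (Kernel k f) gs
  gs-kernel = (0 , 0 , ℕ.s≤s ℕ.z≤n , λ n → cong f (sym (trans (ℕ.+-identityʳ (1 ℕ.* n)) (ℕ.*-identityˡ n))))
    -- These are kernel members because r < L D ≤ E D = k; this is where L ≤ E enters.
    ∷ All.cartesianProductWith⁺ (setoid ℕ) (setoid ℕ) G (upTo L) (upTo (L ℕ.* D))
        (λ {l} {r} _ r∈ → suc l , r
          , ℕ.<-≤-trans (∈ₚ.∈-upTo⁻ r∈) (ℕ.≤-trans (ℕ.*-monoˡ-≤ D L≤E) (k≤k^1+l l)) , λ _ → refl)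

  Spanned : (ℕ → ℤ) → Set
  Spanned = Span sequences (_∈ gs)

  initial : ∀ l → l ℕ.< L → ∀ r → r ℕ.< L ℕ.* D → Spanned (G l r)
  initial l l<L r r<R = gen (there (Any.map (λ { refl _ → refl })
    (∈ₚ.∈-cartesianProductWith⁺ G (∈ₚ.∈-upTo⁺ l<L) (∈ₚ.∈-upTo⁺ r<R))))

  all-r : ∀ l → l ℕ.< L → ∀ r → Spanned (G l r)
  all-r l l<L = Kills-Span D 0<D (ones L) (G l)
    (λ n → Kills-difference D (ones (length qs)) (λ r → ι (G l r n))
      (λ r → Q (k ℕ.^ suc l ℕ.* n ℕ.+ r))
      (λ r → trans (cong (λ m → ι (f m) - Q m) (shift (k ℕ.^ suc l ℕ.* n) r)) (periodic (k ℕ.^ suc l ℕ.* n ℕ.+ r) 1))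
      (Kills-ones-evalℚ {N = λ r → ι (ℤ.+ (k ℕ.^ suc l ℕ.* n ℕ.+ r))} {d = ι (ℤ.+ D)}
        (λ r → trans (cong (ι ∘ ℤ.+_) (sym (ℕ.+-assoc (k ℕ.^ suc l ℕ.* n) r D)))
                 (ι-+ (ℤ.+ (k ℕ.^ suc l ℕ.* n ℕ.+ r)) (ℤ.+ D)))
        (q ∷ qs)))
    (λ r r< → initial l l<L r (subst (λ m → r ℕ.< m ℕ.* D) (List.length-replicate L) r<))
    where
    shift : ∀ x r → x ℕ.+ (r ℕ.+ D) ≡ 1 ℕ.* D ℕ.+ (x ℕ.+ r)
    shift x r = trans (sym (ℕ.+-assoc x r D))
      (trans (ℕ.+-comm (x ℕ.+ r) D) (cong (ℕ._+ (x ℕ.+ r)) (sym (ℕ.*-identityˡ D))))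

  all-l : ∀ r l → Spanned (G l r)
  all-l r = Kills-Span 1 (ℕ.s≤s ℕ.z≤n) (powers (ℤ.+ k) L) (λ l → G l r)
    (λ n → Kills-difference 1 (map (ℤ.+ k ℤ.*_) (powers (ℤ.+ k) (length qs))) (λ l → ι (G l r n))
      (λ l → Q (k ℕ.^ suc l ℕ.* n ℕ.+ r))
      (λ l → trans (residue n (l ℕ.+ 1)) (sym (residue n l)))
      (Kills-cong 1 (powers (ℤ.+ k) L)
        (λ l → cong (evalℚ (q ∷ qs)) (ι-+ (ℤ.+ (k ℕ.^ suc l ℕ.* n)) (ℤ.+ r)))
        (Kills-powers-evalℚ {κ = ℤ.+ k} {P = λ l → ι (ℤ.+ (k ℕ.^ suc l ℕ.* n))}
          (λ l → trans (cong (λ m → ι (ℤ.+ m)) (trans (cong (λ i → k ℕ.* k ℕ.^ i ℕ.* n) (ℕ.+-comm l 1))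
                     (ℕ.*-assoc k (k ℕ.^ suc l) n)))
                   (trans (cong ι (ℤ.pos-* k (k ℕ.^ suc l ℕ.* n))) (ι-* (ℤ.+ k) (ℤ.+ (k ℕ.^ suc l ℕ.* n)))))
          (ι (ℤ.+ r)) (q ∷ qs))))
    (λ l l< → all-r l (subst (l ℕ.<_) (trans (ℕ.*-identityʳ _) (length-powers (ℤ.+ k) L)) l<) r)
    where
    multiple : ∀ n l → k ℕ.^ suc l ℕ.* n ≡ E ℕ.* (k ℕ.^ l ℕ.* n) ℕ.* D
    multiple n l = solveℕ 4 (λ e d x n → e :*ℕ d :*ℕ x :*ℕ n :=ℕ e :*ℕ (x :*ℕ n) :*ℕ d) refl E D (k ℕ.^ l) n
      where open ℕ.+-*-Solver renaming (solve to solveℕ; _:*_ to _:*ℕ_; _:=_ to _:=ℕ_)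

    residue : ∀ n l → ι (G l r n) - Q (k ℕ.^ suc l ℕ.* n ℕ.+ r) ≡ ι (f r) - Q r
    residue n l = trans (cong (λ m → ι (f (m ℕ.+ r)) - Q (m ℕ.+ r)) (multiple n l))
      (periodic r (E ℕ.* (k ℕ.^ l ℕ.* n)))

  kernel∈ : ∀ l r → r ℕ.< k ℕ.^ l → Spanned (λ n → f (k ℕ.^ l ℕ.* n ℕ.+ r))
  kernel∈ zero    zero    _ = gen (here (λ n → cong f (trans (ℕ.+-identityʳ (1 ℕ.* n)) (ℕ.*-identityˡ n))))
  kernel∈ zero    (suc r) (ℕ.s≤s ())
  kernel∈ (suc l) r       _ = all-l r l

rational⇒regular : ∀ p f → (∀ n → f n IsFloorOf eval p (fromℕ n)) →
                   All IsRational (drop 1 p) → Regular f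
rational⇒regular []      f floors _ = periodic⇒regular 1 2 f 0ℚ [] ℕ.≤-refl ℕ.≤-refl (ℕ.s≤s ℕ.z≤n) λ n i →
  cong₂ _-_ (cong ι (constant (i ℕ.* 1 ℕ.+ n) n))
        (trans (vanishes (ι (ℤ.+ (i ℕ.* 1 ℕ.+ n)))) (sym (vanishes (ι (ℤ.+ n)))))
  where
  constant : ∀ m n → f m ≡ f n
  constant m n = trans
    (floor-translate (f n) (f m) ℤ.0ℤ (fromℚ 0ℚ) (fromℚ 0ℚ) (floors n) (floors m)
      (Null-cong {t = λ _ → 0ℚ} (λ _ → refl) Null-0))
    (ℤ.+-identityʳ (f n))

  vanishes : ∀ t → evalℚ (0ℚ ∷ []) t ≡ 0ℚ
  vanishes t = trans (ℚ.+-identityˡ (t * 0ℚ)) (ℚ.*-zeroʳ t)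
rational⇒regular (c ∷ p) f floors r =
  let qs = coefficients r
      D , 0<D , qsD = common-denominator (0ℚ ∷ qs)
      E = suc (suc (length qs))
  in periodic⇒regular D E f 0ℚ qs
       (ℕ.*-mono-≤ {2} {E} {1} {D} (ℕ.s≤s (ℕ.s≤s ℕ.z≤n)) 0<D) 0<D (ℕ.n≤1+n (suc (length qs)))
       (λ n i → floor-minus-poly {c} r {f} floors n (i ℕ.* D ℕ.+ n)
          (difference qs D qsD n i))
  where
  difference : ∀ qs D → All (λ q → Integral (q * ι (ℤ.+ D))) (0ℚ ∷ qs) → ∀ n i →
    Integral (evalℚ (0ℚ ∷ qs) (ι (ℤ.+ (i ℕ.* D ℕ.+ n))) - evalℚ (0ℚ ∷ qs) (ι (ℤ.+ n)))
  difference qs D qsD n i = transport (ℤ.+ i ℤ.* ℤ.+ D) (ℤ.+ n)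
      (trans (ℤ.+-comm (ℤ.+ n) (ℤ.+ i ℤ.* ℤ.+ D)) (cong (λ m → m ℤ.+ ℤ.+ n) (sym (ℤ.pos-* i D))))
      (All.map (λ {p} int → subst Integral
         (trans (solve 3 (λ i p d → i :* (p :* d) := p :* (i :* d)) refl (ι (ℤ.+ i)) p (ι (ℤ.+ D)))
         (cong (p *_) (sym (ι-* (ℤ.+ i) (ℤ.+ D))))) (Integral-* (ℤ.+ i , refl) int)) qsD)
    where
    transport : ∀ d z {w} → z ℤ.+ d ≡ w → All (λ q → Integral (q * ι d)) (0ℚ ∷ qs) →
      Integral (evalℚ (0ℚ ∷ qs) (ι w) - evalℚ (0ℚ ∷ qs) (ι z))
    transport d z refl qsd = subst (λ t → Integral (evalℚ (0ℚ ∷ qs) t - evalℚ (0ℚ ∷ qs) (ι z))) (sym (ι-+ z d))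
      (evalℚ-difference (ι d) (d , refl) qsd (ι z) (z , refl))

theorem1 : (p : Polynomial) (f : ℕ → ℤ) →
    (∀ n → f n IsFloorOf eval p (fromℕ n)) →
    Regular f ⇔ All IsRational (drop 1 p)
theorem1 p f floors = mk⇔ (regular⇒rational p f floors) (rational⇒regular p f floors)
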